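{- For every $n\ge1$, the map $\phi:\mathcal{M}_n\to\mathcal{M}_n$ is a bijection, and $ne(\phi(M))=st(M)$ for every $M\in\mathcal{M}_n$.
   Context: A matching on $[2n]$ is a partition of $\{1,\dots,2n\}$ into $n$ two-element blocks (edges), written $(a,b)$ with $a<b$; $\mathcal{M}_n$ is the set of them. Edges $(a,b),(c,d)$ with $a<c$ are crossed if $a<c<b<d$, nested if $a<c<d<b$, aligned otherwise. $ne(M)$ is the number of nested pairs of edges of $M$. The statistic $st$: order the edges $e_1,\dots,e_n$ of $M$ by increasing left endpoints; if $e_i=(a,b)$ and $e_{i+1}=(c,d)$ are nested, $st_i(M)$ is the number of vertices $v$ with $d\le v\le b$ that belong to some edge $e_k$ with $k>i$; otherwise $st_i(M)=0$; $st(M)=\sum_{i=1}^{n-1}st_i(M)$. The map $\phi$ is defined recursively. If $n=1$, $\phi(M)=M$. If $n>1$, let $e_1=(1,r)$ be the first edge of $M$ and $e_2$ the second edge of $M$ (ordered by left endpoints). Let $M_1$ be the matching obtained by deleting $e_1$ (and its vertices) from $M$ and renumbering to $[2n-2]$ order-preservingly; let $N_1=\phi(M_1)$; let $N_2$ be the matching on $[2n]$ obtained by putting back the vertices $1,r$ and the edge $e_1=(1,r)$ in their original positions (so $N_2$ restricted to $[2n]\setminus\{1,r\}$ is $N_1$ transported order-preservingly). Three cases, according to the relation of $e_1,e_2$ in $M$: Case 1 ($e_1,e_2$ aligned): $\phi(M)=N_2$. Case 2 ($e_1,e_2$ crossed): let $f_2=e_2=(l_2,r_2),f_3=(l_3,r_3),\dots,f_k=(l_k,r_k)$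 be the edges of $N_2$ crossing $e_1$, with $2=l_2<l_3<\dots<l_k$. Remove these edges and instead connect $r_2$ to $l_3$, $r_3$ to $l_4$, ..., $r_{k-1}$ to $l_k$; insert one new vertex immediately before $r$ and connect it to $r_k$; delete the vertex $l_2$ and renumber the vertices to $[2n]$ order-preservingly. The result is $\phi(M)$. Case 3 ($e_1,e_2$ nested, $e_2=(2,q)$ with $q<r$): in $N_2$ let $f_1=(l_1,r_1),\dots,f_p=(l_p,r_p)$ be the edges crossing both $e_1$ and $e_2$, and $f_{p+1}=(l_{p+1},r_{p+1}),\dots,f_{p+s}=(l_{p+s},r_{p+s})$ the edges crossing $e_1$ but not $e_2$, with $l_1<\dots<l_p<q<l_{p+1}<\dots<l_{p+s}$; write $\{l_1,\dots,l_p,q,l_{p+1},\dots,l_{p+s}\}=\{v_1<v_2<\dots<v_{p+s+1}\}$. Remove the edges $e_2,f_1,\dots,f_{p+s}$; insert one new vertex immediately before $r$ and connect it to $v_{s+1}$; connect $r_1,\dots,r_{p+s}$ respectively to $v_1,\dots,v_s,v_{s+2},\dots,v_{p+s+1}$ (in that order); delete the vertex $2$ and renumber the vertices to $[2n]$ order-preservingly. The result is $\phi(M)$. -}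

module Defs where

open import Data.Nat using (ℕ; zero; suc; _+_; _*_; _∸_; _<_; _<ᵇ_; _≤ᵇ_; _≡ᵇ_; _⊓_; _⊔_)
open import Data.Bool using (Bool; true; false; if_then_else_; _∧_; _∨_; not)
open import Data.List using (List; []; _∷_; _++_; map; length; filterᵇ; zipWith; concatMap; applyUpTo; foldl; drop)
open import Data.List.Relation.Unary.All using (All)
open import Data.List.Relation.Unary.Linked using (Linked)
open import Data.List.Relation.Binary.Permutation.Propositional using (_↭_)
open import Data.Product using (_×_; _,_; proj₁; proj₂)

-- An edge (a , b); in a matching we always have a < b.
Edge : Set
Edge = ℕ × ℕ

-- A (raw) matching is the list of its edges.  Canonical form: edges listed
-- by strictly increasing left endpoint (this is the ordering e₁,…,eₙ).
RawMatching : Set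
RawMatching = List Edge

vertices : RawMatching → List ℕ
vertices = concatMap (λ e → proj₁ e ∷ proj₂ e ∷ [])

range2n : ℕ → List ℕ
range2n n = applyUpTo suc (2 * n)

IsMatching : ℕ → RawMatching → Set
IsMatching n M =
  Linked (λ e f → proj₁ e < proj₁ f) M
  × All (λ e → proj₁ e < proj₂ e) M
  × (vertices M ↭ range2n n)

-- Relations between edges (edges assumed to satisfy a < b, c < d)

crossedᵇ : Edge → Edge → Bool
crossedᵇ (a , b) (c , d) =
  ((a <ᵇ c) ∧ (c <ᵇ b) ∧ (b <ᵇ d)) ∨ ((c <ᵇ a) ∧ (a <ᵇ d) ∧ (d <ᵇ b))

nestedᵇ : Edge → Edge → Bool
nestedᵇ (a , b) (c , d) =
  ((a <ᵇ c) ∧ (d <ᵇ b)) ∨ ((c <ᵇ a) ∧ (b <ᵇ d))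

count : {A : Set} → (A → Bool) → List A → ℕ
count p xs = length (filterᵇ p xs)

ne : RawMatching → ℕ
ne [] = 0
ne (e ∷ es) = count (nestedᵇ e) es + ne es

st : RawMatching → ℕ
st [] = 0
st (e ∷ []) = 0
st ((a , b) ∷ (c , d) ∷ rest) =
  (if nestedᵇ (a , b) (c , d)
     then count (λ v → (d ≤ᵇ v) ∧ (v ≤ᵇ b)) (vertices ((c , d) ∷ rest))
     else 0)
  + st ((c , d) ∷ rest)

insertE : Edge → List Edge → List Edge
insertE e [] = e ∷ []
insertE e (f ∷ fs) = if proj₁ e ≤ᵇ proj₁ f then e ∷ f ∷ fs else f ∷ insertE e fs

sortE : List Edge → List Edge
sortE [] = []
sortE (e ∷ es) = insertE e (sortE es)

insertℕ : ℕ → List ℕ → List ℕ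
insertℕ x [] = x ∷ []
insertℕ x (y ∷ ys) = if x ≤ᵇ y then x ∷ y ∷ ys else y ∷ insertℕ x ys

norm : Edge → Edge
norm (a , b) = (a ⊓ b , a ⊔ b)

mapE : (ℕ → ℕ) → List Edge → List Edge
mapE g = map (λ e → g (proj₁ e) , g (proj₂ e))

lastOr : ℕ → List ℕ → ℕ
lastOr = foldl (λ _ x → x)

nthOr : ℕ → List ℕ → ℕ → ℕ
nthOr d [] _ = d
nthOr d (x ∷ xs) zero = x
nthOr d (x ∷ xs) (suc i) = nthOr d xs i

removeNth : List ℕ → ℕ → List ℕ
removeNth [] _ = []
removeNth (x ∷ xs) zero = xs
removeNth (x ∷ xs) (suc i) = x ∷ removeNth xs i

-- delete vertices 1 and r from [2n], renumber to [2n-2]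
delRenum : ℕ → ℕ → ℕ
delRenum r v = if r <ᵇ v then v ∸ 2 else v ∸ 1

-- inverse: put back vertices 1 and r
insRenum : ℕ → ℕ → ℕ
insRenum r v = if v + 1 <ᵇ r then v + 1 else v + 2

-- insert a new vertex immediately before r, delete vertex l (l < r), renumber;
-- an old vertex v ≠ l goes to finalRenum l r v, the new vertex goes to r ∸ 1.
finalRenum : ℕ → ℕ → ℕ → ℕ
finalRenum l r v = if v <ᵇ l then v else (if v <ᵇ r then v ∸ 1 else v)

-- Case 2: C = edges of N₂ crossing e₁ (sorted by left endpoint),
-- others = remaining edges of N₂, l₂ = vertex to delete.
case2 : ℕ → ℕ → List Edge → List Edge → RawMatching
case2 l₂ r C others =
  let g  = finalRenum l₂ r
      Ls = map proj₁ C
      Rs = map proj₂ C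
      chain = zipWith (λ ri lj → norm (g ri , g lj)) Rs (drop 1 Ls)
      newE  = norm (r ∸ 1 , g (lastOr 0 Rs))
  in sortE (newE ∷ chain ++ mapE g others)

-- Case 3: e₂ = (l₂ , q); C = edges of N₂ crossing e₁ (sorted by left endpoint),
-- others = remaining edges of N₂ other than e₂.
case3 : ℕ → ℕ → ℕ → List Edge → List Edge → RawMatching
case3 l₂ q r C others =
  let g  = finalRenum l₂ r
      Ls = map proj₁ C
      Rs = map proj₂ C
      V  = insertℕ q Ls
      s  = count (λ e → q <ᵇ proj₁ e) C
      newE = norm (r ∸ 1 , g (nthOr 0 V s))
      new  = zipWith (λ ri v → norm (g ri , g v)) Rs (removeNth V s)
  in sortE (newE ∷ new ++ mapE g others)

isEdgeᵇ : Edge → Edge → Bool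
isEdgeᵇ (a , b) (c , d) = (a ≡ᵇ c) ∧ (b ≡ᵇ d)

φ' : ℕ → RawMatching → RawMatching
φ' zero M = M
φ' (suc k) [] = []
φ' (suc k) (e ∷ []) = e ∷ []
φ' (suc k) ((a , r) ∷ (l₂ , r₂) ∷ rest) =
  let M₁ = mapE (delRenum r) ((l₂ , r₂) ∷ rest)
      N₁ = φ' k M₁
      N₂ = sortE ((a , r) ∷ mapE (insRenum r) N₁)
      C  = filterᵇ (crossedᵇ (a , r)) N₂
      others = filterᵇ (λ f → not (crossedᵇ (a , r) f) ∧ not (isEdgeᵇ (a , r) f)) N₂
      others₃ = filterᵇ (λ f → not (isEdgeᵇ (l₂ , r₂) f)) others
  in if r <ᵇ l₂ then N₂
     else (if r <ᵇ r₂ then case2 l₂ r C ((a , r) ∷ others)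
           else case3 l₂ r₂ r C ((a , r) ∷ others₃))

φ : RawMatching → RawMatching
φ M = φ' (length M) M

{-# OPTIONS --safe #-}
module Submission where

-- Let (1 , 1 + t) be the first edge of M and N = φ(M₁), whose first edge (1 , b)
-- is that of M₁.  After all renumberings, φ(M) arises from N by opening a gap for
-- two new vertices t, 1 + t (v ↦ shiftAt t v), joining 1 to 1 + t, and rewiring
-- only the edges across the gap.  Their right ends keep their order; their left
-- ends ls become ls ∷ʳ t in Case 2 (t ≤ b, where (1 , b) itself is across the gap),
-- and ls with b inserted and one slot freed for t in Case 3 (b < t).
-- Nestings among edges across the gap depend only on the sequence of their right
-- ends, so ne can be compared edge by edge over the remaining edges: it is unchanged
-- in Case 2 and grows by #{v : b ≤ v < t} = st₁(M) in Case 3.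
-- The edges across the gap, the edge closing at t and the rest are recognisable in
-- φ(M), whence injectivity; surjectivity follows since there are finitely many matchings.

open import Defs
open import Data.Nat using (ℕ; zero; suc; _+_; _*_; _∸_; _≤_; _<_; z≤n; s≤s; _<ᵇ_; _≤ᵇ_; _≡ᵇ_)
open import Data.Nat.Properties
open import Data.Nat.ListAction using (sum)
open import Data.Nat.ListAction.Properties using (sum-↭)
open import Data.Nat.Solver using (module +-*-Solver)
open +-*-Solver using (solve; _:+_; _:=_; con)
open import Data.Bool using (Bool; true; false; if_then_else_; _∧_; _∨_; not; T)
open import Data.Bool.Properties using (∨-comm; ∧-zeroʳ; ∧-identityʳ; ∨-identityʳ; T?; not-involutive)
open import Data.Empty using (⊥; ⊥-elim)
open import Data.Fin using (Fin; toℕ)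
open import Data.Fin.Properties using (pigeonhole)
open import Data.List using (lookup; List; []; _∷_; _++_; _∷ʳ_; [_]; map; length; filterᵇ; zip; zipWith; applyUpTo; drop; cartesianProduct; cartesianProductWith)
open import Data.List.Properties using (∷-injective; ∷ʳ-injectiveˡ; length-filter; length-++; map-∘; map-cong-local; map-id-local; map-++; length-map; length-applyUpTo; applyUpTo-∷ʳ; map-applyUpTo; ++-assoc; ++-identityʳ; filter-++)
open import Data.List.Membership.Propositional using (_∈_)
open import Data.List.Membership.Propositional.Properties using (∈-cartesianProductWith⁺; ∈-cartesianProduct⁺)
open import Data.List.Relation.Unary.All using (All; []; _∷_)
import Data.List.Relation.Unary.All as All
import Data.List.Relation.Unary.All.Properties as All
open import Data.List.Relation.Unary.Any using (here; there; index)
open import Data.List.Relation.Unary.Any.Properties using (lookup-index)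
open import Data.List.Relation.Unary.AllPairs using (AllPairs; []; _∷_)
import Data.List.Relation.Unary.AllPairs as AllPairs
import Data.List.Relation.Unary.AllPairs.Properties as AllPairs
open import Data.List.Relation.Unary.Linked.Properties using (AllPairs⇒Linked; Linked⇒AllPairs)
open import Data.List.Relation.Unary.Unique.Propositional using (Unique)
open import Data.List.Relation.Binary.Permutation.Propositional using (_↭_; ↭-refl; ↭-sym; ↭-trans; ↭-prep; ↭-swap; ↭-reflexive; ↭⇒↭ₛ; module PermutationReasoning)
import Data.List.Relation.Binary.Permutation.Propositional as Perm
open import Data.List.Relation.Binary.Permutation.Propositional.Properties using (All-resp-↭; ∈-resp-↭; map⁺; ↭-length; ++⁺; ++⁺ˡ; ++⁺ʳ; shift; drop-∷; ∷↭∷ʳ; filter-↭; ↭-empty-inv; ↭-singleton-inv; ¬x∷xs↭[])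
import Data.List.Relation.Binary.Permutation.Setoid.Properties as PermSetoid
open import Data.Product using (Σ; ∃; _×_; _,_; proj₁; proj₂)
open import Data.Sum using (_⊎_; inj₁; inj₂)
open import Function using (_∘_)
open import Relation.Binary using (tri<; tri≈; tri>)
open import Relation.Nullary using (yes; no; contradiction)
open import Relation.Binary.PropositionalEquality using (_≡_; _≢_; refl; sym; trans; cong; cong₂; subst; subst₂; setoid; module ≡-Reasoning)


-- The recursion needs its own invariant: the case of φ is decided by the second edge of M while the
-- surgery is done on N, and both speak of the same edge only because φ fixes the first edge of
-- every matching. In the coordinates of N a vertex v < t lands inside the new first edge and v ≥ t
-- beyond it, so an edge of N that is not across the gap lies wholly below or wholly above it. The
-- two kinds see different halves of the edges across the gap: an edge below is nested in those
-- whose left end precedes it, an edge above in those whose right end follows it. For these nestings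
-- the pairing of the ends across the gap is irrelevant. The choice of the freed slot in Case 3 has
-- a double purpose. If s left ends across the gap exceed b, the freed slot has exactly s slots
-- before it. Hence the edge closing at t is nested in s rewired edges, which pays for these s
-- vertices in st₁(M); and b can be found again from the slots and s.

<ᵇ-true : ∀ {m n} → m < n → (m <ᵇ n) ≡ true
<ᵇ-true {m} {n} m<n with m <ᵇ n | <⇒<ᵇ m<n
... | true | _ = refl

<ᵇ-false : ∀ {m n} → n ≤ m → (m <ᵇ n) ≡ false
<ᵇ-false {m} {n} n≤m with m <ᵇ n in eq
... | false = refl
... | true  = contradiction (<ᵇ⇒< m n (subst T (sym eq) _)) (≤⇒≯ n≤m)

<ᵇ-suc : ∀ m n → (m ≤ᵇ n) ≡ (m <ᵇ suc n)
<ᵇ-suc zero    n = refl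
<ᵇ-suc (suc m) n = refl

≤ᵇ-true : ∀ {m n} → m ≤ n → (m ≤ᵇ n) ≡ true
≤ᵇ-true {m} {n} m≤n = trans (<ᵇ-suc m n) (<ᵇ-true (s≤s m≤n))

≤ᵇ-false : ∀ {m n} → n < m → (m ≤ᵇ n) ≡ false
≤ᵇ-false {m} {n} n<m = trans (<ᵇ-suc m n) (<ᵇ-false n<m)

≡ᵇ-refl : ∀ n → (n ≡ᵇ n) ≡ true
≡ᵇ-refl zero    = refl
≡ᵇ-refl (suc n) = ≡ᵇ-refl n

≡ᵇ-false : ∀ {m n} → m ≢ n → (m ≡ᵇ n) ≡ false
≡ᵇ-false {m} {n} m≢n with m ≡ᵇ n in eq
... | false = refl
... | true  = contradiction (≡ᵇ⇒≡ m n (subst T (sym eq) _)) m≢n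

<ᵇ≡true⇒< : ∀ {m n} → (m <ᵇ n) ≡ true → m < n
<ᵇ≡true⇒< {m} {n} eq = <ᵇ⇒< m n (subst T (sym eq) _)

-- An equality of Boolean tests, so that it rewrites directly inside `nestedᵇ` and the predicates
-- that are counted.
Embedding : (ℕ → ℕ) → Set
Embedding f = ∀ x y → (f x <ᵇ f y) ≡ (x <ᵇ y)

embedding-mono : ∀ {f} → Embedding f → ∀ {x y} → x < y → f x < f y
embedding-mono emb {x} {y} x<y = <ᵇ≡true⇒< (trans (emb x y) (<ᵇ-true x<y))

embedding-reflects : ∀ {f} → Embedding f → ∀ {x y} → f x < f y → x < y
embedding-reflects emb {x} {y} fx<fy = <ᵇ≡true⇒< (trans (sym (emb x y)) (<ᵇ-true fx<fy))

mono⇒embedding : ∀ f → (∀ {x y} → x < y → f x < f y) → Embedding f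
mono⇒embedding f mono x y with <-cmp x y
... | tri< x<y _ _ = trans (<ᵇ-true (mono x<y)) (sym (<ᵇ-true x<y))
... | tri≈ _ refl _ = trans (<ᵇ-false (≤-refl {f x})) (sym (<ᵇ-false (≤-refl {x})))
... | tri> _ _ y<x = trans (<ᵇ-false (<⇒≤ (mono y<x))) (sym (<ᵇ-false (<⇒≤ y<x)))

-- Filters, weighted sums and counts over lists

filterᵇ-accept : ∀ {A : Set} (p : A → Bool) {x xs} → p x ≡ true → filterᵇ p (x ∷ xs) ≡ x ∷ filterᵇ p xs
filterᵇ-accept p eq rewrite eq = refl

filterᵇ-reject : ∀ {A : Set} (p : A → Bool) {x xs} → p x ≡ false → filterᵇ p (x ∷ xs) ≡ filterᵇ p xs
filterᵇ-reject p eq rewrite eq = refl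

filterᵇ-all : ∀ {A : Set} (p : A → Bool) {xs} → All (λ x → p x ≡ true) xs → filterᵇ p xs ≡ xs
filterᵇ-all p []         = refl
filterᵇ-all p (px ∷ pxs) = trans (filterᵇ-accept p px) (cong (_ ∷_) (filterᵇ-all p pxs))

filterᵇ-none : ∀ {A : Set} (p : A → Bool) {xs} → All (λ x → p x ≡ false) xs → filterᵇ p xs ≡ []
filterᵇ-none p []         = refl
filterᵇ-none p (px ∷ pxs) = trans (filterᵇ-reject p px) (filterᵇ-none p pxs)

filterᵇ-map : ∀ {A B : Set} {p : B → Bool} {q : A → Bool} (f : A → B) {xs} →
  All (λ x → p (f x) ≡ q x) xs → filterᵇ p (map f xs) ≡ map f (filterᵇ q xs)
filterᵇ-map f [] = refl
filterᵇ-map {p = p} {q} f {x ∷ xs} (eq ∷ eqs) with q x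
... | true  = trans (filterᵇ-accept p eq) (cong (f x ∷_) (filterᵇ-map f eqs))
... | false = trans (filterᵇ-reject p eq) (filterᵇ-map f eqs)

filterᵇ-satisfies : ∀ {A : Set} (p : A → Bool) xs → All (λ x → p x ≡ true) (filterᵇ p xs)
filterᵇ-satisfies p [] = []
filterᵇ-satisfies p (x ∷ xs) with p x in eq
... | true  = eq ∷ filterᵇ-satisfies p xs
... | false = filterᵇ-satisfies p xs

All-filterᵇ : ∀ {A : Set} {P : A → Set} (p : A → Bool) {xs} → All P xs → All P (filterᵇ p xs)
All-filterᵇ p = All.filter⁺ (T? ∘ p)

filterᵇ-partition : ∀ {A : Set} (p : A → Bool) xs → xs ↭ filterᵇ p xs ++ filterᵇ (not ∘ p) xs
filterᵇ-partition p [] = ↭-refl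
filterᵇ-partition p (x ∷ xs) with p x
... | true  = ↭-prep x (filterᵇ-partition p xs)
... | false = ↭-trans (↭-prep x (filterᵇ-partition p xs)) (↭-sym (shift x _ _))

⟦_⟧ : Bool → ℕ
⟦ false ⟧ = 0
⟦ true  ⟧ = 1

total : ∀ {A : Set} → (A → ℕ) → List A → ℕ
total f xs = sum (map f xs)

count-total : ∀ {A : Set} (p : A → Bool) xs → count p xs ≡ total (⟦_⟧ ∘ p) xs
count-total p [] = refl
count-total p (x ∷ xs) with p x
... | true  = cong suc (count-total p xs)
... | false = count-total p xs

total-cong : ∀ {A : Set} {f g : A → ℕ} {xs} → All (λ x → f x ≡ g x) xs → total f xs ≡ total g xs
total-cong eqs = cong sum (map-cong-local eqs)

total-map : ∀ {A B : Set} (f : B → ℕ) (g : A → B) xs → total f (map g xs) ≡ total (f ∘ g) xs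
total-map f g xs = cong sum (sym (map-∘ xs))

total-↭ : ∀ {A : Set} (f : A → ℕ) {xs ys} → xs ↭ ys → total f xs ≡ total f ys
total-↭ f p = sum-↭ (map⁺ f p)

total-++ : ∀ {A : Set} (f : A → ℕ) xs ys → total f (xs ++ ys) ≡ total f xs + total f ys
total-++ f []       ys = refl
total-++ f (x ∷ xs) ys = trans (cong (f x +_) (total-++ f xs ys)) (sym (+-assoc (f x) _ _))

total-+ : ∀ {A : Set} (f g : A → ℕ) xs → total (λ x → f x + g x) xs ≡ total f xs + total g xs
total-+ f g [] = refl
total-+ f g (x ∷ xs) rewrite total-+ f g xs =
  solve 4 (λ a b c d → (a :+ b) :+ (c :+ d) := (a :+ c) :+ (b :+ d)) refl (f x) (g x) (total f xs) (total g xs)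

total-zero : ∀ {A : Set} {f : A → ℕ} {xs} → All (λ x → f x ≡ 0) xs → total f xs ≡ 0
total-zero []         = refl
total-zero (eq ∷ eqs) = cong₂ _+_ eq (total-zero eqs)

count-↭ : ∀ {A : Set} (p : A → Bool) {xs ys} → xs ↭ ys → count p xs ≡ count p ys
count-↭ p q = ↭-length (filter-↭ (T? ∘ p) q)

count-map : ∀ {A B : Set} {p : B → Bool} {q : A → Bool} (f : A → B) {xs} →
  All (λ x → p (f x) ≡ q x) xs → count p (map f xs) ≡ count q xs
count-map {q = q} f {xs} eqs = trans (cong length (filterᵇ-map f eqs)) (length-map f (filterᵇ q xs))

-- Strictly sorted lists, sorting, insertion and selection

strictly-sorted-unique : ∀ {A : Set} {_≺_ : A → A → Set} → (∀ {x y} → x ≺ y → y ≺ x → ⊥) →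
  ∀ {xs ys} → xs ↭ ys → AllPairs _≺_ xs → AllPairs _≺_ ys → xs ≡ ys
strictly-sorted-unique asym {[]} p _ _ = sym (↭-empty-inv (↭-sym p))
strictly-sorted-unique asym {x ∷ xs} {[]} p _ _ = contradiction p ¬x∷xs↭[]
strictly-sorted-unique asym {x ∷ xs} {y ∷ ys} p (x≺ ∷ sxs) (y≺ ∷ sys)
  with ∈-resp-↭ p (here refl) | ∈-resp-↭ (↭-sym p) (here refl)
-- Each head would lie in the tail of the other list and so precede the other head.
... | there x∈ys | there y∈xs = ⊥-elim (asym (All.lookup x≺ y∈xs) (All.lookup y≺ x∈ys))
... | here refl  | _          = cong (x ∷_) (strictly-sorted-unique asym (drop-∷ p) sxs sys)
... | there _    | here refl  = cong (x ∷_) (strictly-sorted-unique asym (drop-∷ p) sxs sys)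

Unique-resp-↭ : ∀ {A : Set} {xs ys : List A} → xs ↭ ys → Unique xs → Unique ys
Unique-resp-↭ {A} p = PermSetoid.Unique-resp-↭ (setoid A) (↭⇒↭ₛ p)

Unique-++ˡ : ∀ {A : Set} (xs : List A) {ys} → Unique (xs ++ ys) → Unique xs
Unique-++ˡ []       _         = []
Unique-++ˡ (x ∷ xs) (x≢ ∷ u)  = All.++⁻ˡ xs x≢ ∷ Unique-++ˡ xs u

infix 4 _<ₗ_

_<ₗ_ : Edge → Edge → Set
e <ₗ f = proj₁ e < proj₁ f

insertE-↭ : ∀ e L → insertE e L ↭ e ∷ L
insertE-↭ e [] = ↭-refl
insertE-↭ e (f ∷ L) with proj₁ e ≤ᵇ proj₁ f
... | true  = ↭-refl
... | false = ↭-trans (↭-prep f (insertE-↭ e L)) (↭-swap f e ↭-refl)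

sortE-↭ : ∀ L → sortE L ↭ L
sortE-↭ []      = ↭-refl
sortE-↭ (e ∷ L) = ↭-trans (insertE-↭ e (sortE L)) (↭-prep e (sortE-↭ L))

insertE-least : ∀ e {L} → All (λ f → proj₁ e ≤ proj₁ f) L → insertE e L ≡ e ∷ L
insertE-least e []      = refl
insertE-least e (e≤f ∷ _) rewrite ≤ᵇ-true e≤f = refl

insertE-sorted : ∀ e {L} → AllPairs _<ₗ_ L → All (λ f → proj₁ e ≢ proj₁ f) L → AllPairs _<ₗ_ (insertE e L)
insertE-sorted e [] _ = [] ∷ []
insertE-sorted e {f ∷ L} (f< ∷ s) (e≢f ∷ e≢) with <-cmp (proj₁ e) (proj₁ f)
... | tri< e<f _ _ rewrite ≤ᵇ-true (<⇒≤ e<f) = (e<f ∷ All.map (<-trans e<f) f<) ∷ f< ∷ s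
... | tri≈ _ eq _ = contradiction eq e≢f
... | tri> _ _ f<e rewrite ≤ᵇ-false f<e =
  All-resp-↭ (↭-sym (insertE-↭ e L)) (f<e ∷ f<) ∷ insertE-sorted e s e≢

sortE-sorted : ∀ L → Unique (map proj₁ L) → AllPairs _<ₗ_ (sortE L)
sortE-sorted []      _        = []
sortE-sorted (e ∷ L) (e≢ ∷ u) =
  insertE-sorted e (sortE-sorted L u) (All-resp-↭ (↭-sym (sortE-↭ L)) (All.map⁻ e≢))

-- Left ends are distinct, so sorting forgets the order in which the cases of φ happen to list their
-- edges.
sortE-cong : ∀ {L L′} → L ↭ L′ → Unique (map proj₁ L) → sortE L ≡ sortE L′
sortE-cong {L} {L′} p u = strictly-sorted-unique <-asym
  (↭-trans (sortE-↭ L) (↭-trans p (↭-sym (sortE-↭ L′))))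
  (sortE-sorted L u) (sortE-sorted L′ (Unique-resp-↭ (map⁺ proj₁ p) u))

sortE-id : ∀ {L} → AllPairs _<ₗ_ L → sortE L ≡ L
sortE-id []       = refl
sortE-id {e ∷ L} (e< ∷ s) rewrite sortE-id s = insertE-least e (All.map <⇒≤ e<)

insertℕ-↭ : ∀ x xs → insertℕ x xs ↭ x ∷ xs
insertℕ-↭ x [] = ↭-refl
insertℕ-↭ x (y ∷ ys) with x ≤ᵇ y
... | true  = ↭-refl
... | false = ↭-trans (↭-prep y (insertℕ-↭ x ys)) (↭-swap y x ↭-refl)

insertℕ-sorted : ∀ x {xs} → AllPairs _<_ xs → All (x ≢_) xs → AllPairs _<_ (insertℕ x xs)
insertℕ-sorted x [] _ = [] ∷ []
insertℕ-sorted x {y ∷ ys} (y< ∷ s) (x≢y ∷ x≢) with <-cmp x y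
... | tri< x<y _ _ rewrite ≤ᵇ-true (<⇒≤ x<y) = (x<y ∷ All.map (<-trans x<y) y<) ∷ y< ∷ s
... | tri≈ _ eq _ = contradiction eq x≢y
... | tri> _ _ y<x rewrite ≤ᵇ-false y<x =
  All-resp-↭ (↭-sym (insertℕ-↭ x ys)) (y<x ∷ y<) ∷ insertℕ-sorted x s x≢

insertℕ-map : ∀ {f} → Embedding f → ∀ x ys → insertℕ (f x) (map f ys) ≡ map f (insertℕ x ys)
insertℕ-map emb x [] = refl
insertℕ-map {f} emb x (y ∷ ys) with <-cmp x y
... | tri< x<y _ _ rewrite ≤ᵇ-true (<⇒≤ x<y) | ≤ᵇ-true (<⇒≤ (embedding-mono {f} emb x<y)) = refl
... | tri≈ _ refl _ rewrite ≤ᵇ-true (≤-refl {x}) | ≤ᵇ-true (≤-refl {f x}) = refl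
... | tri> _ _ y<x rewrite ≤ᵇ-false y<x | ≤ᵇ-false (embedding-mono {f} emb y<x) = cong (f y ∷_) (insertℕ-map emb x ys)

nthOr-↭ : ∀ d xs {i} → i < length xs → xs ↭ nthOr d xs i ∷ removeNth xs i
nthOr-↭ d (x ∷ xs) {zero}  _         = ↭-refl
nthOr-↭ d (x ∷ xs) {suc i} (s≤s i<n) = ↭-trans (↭-prep x (nthOr-↭ d xs i<n)) (↭-swap x _ ↭-refl)

nthOr-map : ∀ (f : ℕ → ℕ) d d′ xs {i} → i < length xs → nthOr d (map f xs) i ≡ f (nthOr d′ xs i)
nthOr-map f d d′ (x ∷ xs) {zero}  _         = refl
nthOr-map f d d′ (x ∷ xs) {suc i} (s≤s i<n) = nthOr-map f d d′ xs i<n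

removeNth-map : ∀ (f : ℕ → ℕ) xs i → removeNth (map f xs) i ≡ map f (removeNth xs i)
removeNth-map f []       i       = refl
removeNth-map f (x ∷ xs) zero    = refl
removeNth-map f (x ∷ xs) (suc i) = cong (f x ∷_) (removeNth-map f xs i)

removeNth-All : ∀ {P : ℕ → Set} {xs} i → All P xs → All P (removeNth xs i)
removeNth-All i       []         = []
removeNth-All zero    (px ∷ pxs) = pxs
removeNth-All (suc i) (px ∷ pxs) = px ∷ removeNth-All i pxs

removeNth-sorted : ∀ {xs} i → AllPairs _<_ xs → AllPairs _<_ (removeNth xs i)
removeNth-sorted i       []       = []
removeNth-sorted zero    (_ ∷ s)  = s
removeNth-sorted (suc i) (x< ∷ s) = removeNth-All i x< ∷ removeNth-sorted i s

-- Turns the index of the freed slot into a count of smaller slots, which is the form in which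
-- nestings see it.
count-below-nth : ∀ d {xs i} → AllPairs _<_ xs → i < length xs → count (_<ᵇ nthOr d xs i) xs ≡ i
count-below-nth d {x ∷ xs} {zero} (x< ∷ _) _ = cong length
  (filterᵇ-none (_<ᵇ x) (<ᵇ-false (≤-refl {x}) ∷ All.map (<ᵇ-false ∘ <⇒≤) x<))
count-below-nth d {x ∷ xs} {suc i} (x< ∷ s) (s≤s i<n) =
  trans (cong length (filterᵇ-accept (_<ᵇ nthOr d xs i) {x} {xs} (<ᵇ-true x<nth))) (cong suc (count-below-nth d s i<n))
  where
  x<nth : x < nthOr d xs i
  x<nth with All-resp-↭ (nthOr-↭ d xs i<n) x<
  ... | p ∷ _ = p

-- Vertex intervals, vertex lists and lists of ends

range : ℕ → List ℕ
range = applyUpTo suc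

range-∷ʳ : ∀ k → range (suc k) ≡ range k ∷ʳ suc k
range-∷ʳ k = sym (applyUpTo-∷ʳ suc k)

range-bounds : ∀ k → All (λ v → 1 ≤ v × v ≤ k) (range k)
range-bounds k = All.applyUpTo⁺₁ suc k (λ i<k → s≤s z≤n , i<k)

range-unique : ∀ k → Unique (range k)
range-unique k = AllPairs.applyUpTo⁺₁ suc k (λ i<j _ eq → <⇒≢ (s≤s i<j) eq)

∈-range : ∀ {v k} → 1 ≤ v → v ≤ k → v ∈ range k
∈-range {suc v} {suc k} _ (s≤s v≤k) = go v k v≤k suc
  where
  go : ∀ v k → v ≤ k → (f : ℕ → ℕ) → f v ∈ applyUpTo f (suc k)
  go zero    k       _         f = here refl
  go (suc v) (suc k) (s≤s v≤k) f = there (go v k v≤k (f ∘ suc))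

vertices-↭-ends : ∀ L → vertices L ↭ map proj₁ L ++ map proj₂ L
vertices-↭-ends []      = ↭-refl
vertices-↭-ends (e ∷ L) = ↭-prep (proj₁ e)
  (↭-trans (↭-prep (proj₂ e) (vertices-↭-ends L)) (↭-sym (shift (proj₂ e) (map proj₁ L) (map proj₂ L))))

vertices-↭ : ∀ {L L′} → L ↭ L′ → vertices L ↭ vertices L′
vertices-↭ {L} {L′} p = ↭-trans (vertices-↭-ends L)
  (↭-trans (++⁺ (map⁺ proj₁ p) (map⁺ proj₂ p)) (↭-sym (vertices-↭-ends L′)))

vertices-++ : ∀ L L′ → vertices (L ++ L′) ≡ vertices L ++ vertices L′
vertices-++ []      L′ = refl
vertices-++ (e ∷ L) L′ = cong (λ vs → proj₁ e ∷ proj₂ e ∷ vs) (vertices-++ L L′)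

vertices-mapE : ∀ f L → vertices (mapE f L) ≡ map f (vertices L)
vertices-mapE f []      = refl
vertices-mapE f (e ∷ L) = cong (λ vs → f (proj₁ e) ∷ f (proj₂ e) ∷ vs) (vertices-mapE f L)

All-ends : ∀ {P : ℕ → Set} {L} → All P (vertices L) → All (λ e → P (proj₁ e) × P (proj₂ e)) L
All-ends {L = []}    []             = []
All-ends {L = e ∷ L} (pa ∷ pb ∷ ps) = (pa , pb) ∷ All-ends ps

All-vertices : ∀ {P : ℕ → Set} {L} → All (λ e → P (proj₁ e) × P (proj₂ e)) L → All P (vertices L)
All-vertices []               = []
All-vertices ((pa , pb) ∷ ps) = pa ∷ pb ∷ All-vertices ps

mapE-id-local : ∀ {f L} → All (λ v → f v ≡ v) (vertices L) → mapE f L ≡ L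
mapE-id-local eqs = map-id-local (All.map (λ (p , q) → cong₂ _,_ p q) (All-ends eqs))

mapE-cong-local : ∀ {f g L} → All (λ v → f v ≡ g v) (vertices L) → mapE f L ≡ mapE g L
mapE-cong-local eqs = map-cong-local (All.map (λ (p , q) → cong₂ _,_ p q) (All-ends eqs))

mapE-∘ : ∀ f g L → mapE f (mapE g L) ≡ mapE (f ∘ g) L
mapE-∘ f g L = sym (map-∘ L)

lefts-mapE : ∀ f L → map proj₁ (mapE f L) ≡ map f (map proj₁ L)
lefts-mapE f L = trans (sym (map-∘ L)) (map-∘ L)

rights-mapE : ∀ f L → map proj₂ (mapE f L) ≡ map f (map proj₂ L)
rights-mapE f L = trans (sym (map-∘ L)) (map-∘ L)

zip-ends : ∀ (L : List Edge) → zip (map proj₁ L) (map proj₂ L) ≡ L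
zip-ends []      = refl
zip-ends (e ∷ L) = cong (e ∷_) (zip-ends L)

lefts-zip : ∀ (ls rs : List ℕ) → length ls ≡ length rs → map proj₁ (zip ls rs) ≡ ls
lefts-zip []       []       _  = refl
lefts-zip (l ∷ ls) (r ∷ rs) eq = cong (l ∷_) (lefts-zip ls rs (suc-injective eq))

rights-zip : ∀ (ls rs : List ℕ) → length ls ≡ length rs → map proj₂ (zip ls rs) ≡ rs
rights-zip []       []       _  = refl
rights-zip (l ∷ ls) (r ∷ rs) eq = cong (r ∷_) (rights-zip ls rs (suc-injective eq))

vertices-zip : ∀ (ls rs : List ℕ) → length ls ≡ length rs → vertices (zip ls rs) ↭ ls ++ rs
vertices-zip ls rs eq = subst₂ (λ xs ys → vertices (zip ls rs) ↭ xs ++ ys)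
  (lefts-zip ls rs eq) (rights-zip ls rs eq) (vertices-↭-ends (zip ls rs))

All-zip : ∀ {P Q : ℕ → Set} {ls rs} → All P ls → All Q rs → All (λ e → P (proj₁ e) × Q (proj₂ e)) (zip ls rs)
All-zip []       _        = []
All-zip (_ ∷ _)  []       = []
All-zip (p ∷ ps) (q ∷ qs) = (p , q) ∷ All-zip ps qs

-- Basic properties of matchings

Ordered : Edge → Set
Ordered e = proj₁ e < proj₂ e

sorted-lefts : ∀ n {M} → IsMatching n M → AllPairs _<ₗ_ M
sorted-lefts n (linked , _) = Linked⇒AllPairs <-trans linked

matching-bounds : ∀ n L → vertices L ↭ range2n n → All (λ v → 1 ≤ v × v ≤ 2 * n) (vertices L)
matching-bounds n L p = All-resp-↭ (↭-sym p) (range-bounds (2 * n))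

unique-lefts : ∀ n L → vertices L ↭ range2n n → Unique (map proj₁ L)
unique-lefts n L p = Unique-++ˡ (map proj₁ L)
  (Unique-resp-↭ (↭-trans (↭-sym p) (vertices-↭-ends L)) (range-unique (2 * n)))

sortE-matching : ∀ n L → All Ordered L → vertices L ↭ range2n n → IsMatching n (sortE L)
sortE-matching n L ord p =
  AllPairs⇒Linked (sortE-sorted L (unique-lefts n L p)) ,
  All-resp-↭ (↭-sym (sortE-↭ L)) ord ,
  ↭-trans (vertices-↭ (sortE-↭ L)) p

matching-unique : ∀ n {M M′} → IsMatching n M → IsMatching n M′ → M ↭ M′ → M ≡ M′
matching-unique n mM mM′ p = strictly-sorted-unique <-asym p (sorted-lefts n mM) (sorted-lefts n mM′)

length-vertices : ∀ L → length (vertices L) ≡ 2 * length L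
length-vertices []      = refl
length-vertices (e ∷ L) = trans (cong (suc ∘ suc) (length-vertices L)) (sym (*-suc 2 (length L)))

matching-length : ∀ n {M} → IsMatching n M → length M ≡ n
matching-length n {M} (_ , _ , p) = *-cancelˡ-≡ (length M) n 2
  (trans (sym (length-vertices M)) (trans (↭-length p) (length-applyUpTo suc (2 * n))))

-- Vertex 1 occurs somewhere, and the left end of the head is least among all vertices: the left
-- ends increase and every right end exceeds its left end.
head-left : ∀ m {a b R} → IsMatching (suc m) ((a , b) ∷ R) → a ≡ 1
head-left m {a} {b} {R} mM@(_ , a<b ∷ ordR , p) = ≤-antisym
  (All.lookup below (∈-resp-↭ (↭-sym p) (here refl)))
  (proj₁ (All.head (matching-bounds (suc m) ((a , b) ∷ R) p)))
  where
  below : All (a ≤_) (vertices ((a , b) ∷ R))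
  below with sorted-lefts (suc m) mM
  ... | a< ∷ _ = All-vertices {L = (a , b) ∷ R}
    ((≤-refl , <⇒≤ a<b) ∷ All.zipWith (λ (a<c , c<d) → <⇒≤ a<c , <⇒≤ (<-trans a<c c<d)) (a< , ordR))

-- Renumberings caused by inserting two vertices

shiftAt : ℕ → ℕ → ℕ
shiftAt t v = if v <ᵇ t then v else 2 + v

shiftAt-below : ∀ {t v} → v < t → shiftAt t v ≡ v
shiftAt-below v<t rewrite <ᵇ-true v<t = refl

shiftAt-above : ∀ {t v} → t ≤ v → shiftAt t v ≡ 2 + v
shiftAt-above t≤v rewrite <ᵇ-false t≤v = refl

insRenum-below : ∀ {t v} → v < t → insRenum (suc t) v ≡ 1 + v
insRenum-below {t} {v} v<t rewrite +-comm v 1 | <ᵇ-true v<t = refl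

insRenum-above : ∀ {t v} → t ≤ v → insRenum (suc t) v ≡ 2 + v
insRenum-above {t} {v} t≤v rewrite +-comm v 1 | <ᵇ-false t≤v = +-comm v 2

shiftAt-embedding : ∀ t → Embedding (shiftAt t)
shiftAt-embedding t = mono⇒embedding (shiftAt t) mono
  where
  mono : ∀ {x y} → x < y → shiftAt t x < shiftAt t y
  mono {x} {y} x<y with x <? t | y <? t
  ... | yes x<t | yes y<t = subst₂ _<_ (sym (shiftAt-below x<t)) (sym (shiftAt-below y<t)) x<y
  ... | yes x<t | no y≮t = subst₂ _<_ (sym (shiftAt-below x<t)) (sym (shiftAt-above (≮⇒≥ y≮t))) (≤-trans x<y (m≤n+m y 2))
  ... | no x≮t | yes y<t = contradiction (<-trans x<y y<t) x≮t
  ... | no x≮t | no y≮t = subst₂ _<_ (sym (shiftAt-above (≮⇒≥ x≮t))) (sym (shiftAt-above (≮⇒≥ y≮t))) (s≤s (s≤s x<y))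

insRenum-embedding : ∀ t → Embedding (insRenum (suc t))
insRenum-embedding t = mono⇒embedding (insRenum (suc t)) mono
  where
  mono : ∀ {x y} → x < y → insRenum (suc t) x < insRenum (suc t) y
  mono {x} {y} x<y with x <? t | y <? t
  ... | yes x<t | yes y<t = subst₂ _<_ (sym (insRenum-below x<t)) (sym (insRenum-below y<t)) (s≤s x<y)
  ... | yes x<t | no y≮t = subst₂ _<_ (sym (insRenum-below x<t)) (sym (insRenum-above (≮⇒≥ y≮t))) (s≤s (m≤n⇒m≤1+n x<y))
  ... | no x≮t | yes y<t = contradiction (<-trans x<y y<t) x≮t
  ... | no x≮t | no y≮t = subst₂ _<_ (sym (insRenum-above (≮⇒≥ x≮t))) (sym (insRenum-above (≮⇒≥ y≮t))) (s≤s (s≤s x<y))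

delRenum-insRenum : ∀ t v → delRenum (suc t) (insRenum (suc t) v) ≡ v
delRenum-insRenum t v with v <? t
... | yes v<t rewrite insRenum-below v<t | <ᵇ-false (<⇒≤ v<t) = refl
... | no v≮t rewrite insRenum-above (≮⇒≥ v≮t) | <ᵇ-true (s≤s (≮⇒≥ v≮t)) = refl

-- On an old vertex, inserting 1 and r = suc t, then inserting a vertex before r
-- and deleting 2, amounts to opening a gap for the vertices t and suc t.
finalRenum-insRenum : ∀ {t v} → 2 ≤ t → 1 ≤ v → finalRenum 2 (suc t) (insRenum (suc t) v) ≡ shiftAt t v
finalRenum-insRenum {t} {suc v} 2≤t _ with suc v <? t
... | yes v<t rewrite insRenum-below v<t | <ᵇ-true v<t = refl
... | no v≮t rewrite insRenum-above (≮⇒≥ v≮t) | <ᵇ-false {suc v} {t} (≮⇒≥ v≮t)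
                   | <ᵇ-false {suc (suc v)} {t} (m≤n⇒m≤1+n (≮⇒≥ v≮t)) = refl

unshiftAt : ℕ → ℕ → ℕ
unshiftAt t v = if v <ᵇ t then v else v ∸ 2

unshiftAt-shiftAt : ∀ t v → unshiftAt t (shiftAt t v) ≡ v
unshiftAt-shiftAt t v with v <? t
... | yes v<t rewrite shiftAt-below v<t | <ᵇ-true v<t = refl
... | no v≮t rewrite shiftAt-above (≮⇒≥ v≮t) | <ᵇ-false {2 + v} {t} (m≤n⇒m≤o+n 2 (≮⇒≥ v≮t)) = refl

-- From `t` on, `f` adds 2, so enlarging `k` only appends one vertex at the end of both sides. Where
-- `x` and `y` were inserted matters only at the smallest size, `t ≡ suc k`; thus one induction
-- serves both renumberings.
range-insert : ∀ {f t x y} → 1 ≤ t →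
  (∀ {v} → t ≤ v → f v ≡ 2 + v) →
  (∀ k → t ≡ suc k → range (2 + k) ↭ x ∷ y ∷ map f (range k)) →
  ∀ k → t ≤ suc k → range (2 + k) ↭ x ∷ y ∷ map f (range k)
range-insert {f} {t} {x} {y} 1≤t above base k t≤1+k with m≤n⇒m<n∨m≡n t≤1+k
... | inj₂ eq = base k eq
range-insert 1≤t above base zero t≤1+k | inj₁ (s≤s t≤0) = contradiction (≤-trans 1≤t t≤0) (λ ())
range-insert {f} {t} {x} {y} 1≤t above base (suc k) t≤1+k | inj₁ (s≤s t≤k) = begin
  range (3 + k)                              ≡⟨ range-∷ʳ (2 + k) ⟩
  range (2 + k) ∷ʳ (3 + k)                   ↭⟨ ++⁺ʳ [ 3 + k ] (range-insert 1≤t above base k t≤k) ⟩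
  x ∷ y ∷ map f (range k) ∷ʳ (3 + k)         ≡⟨ cong (λ v → x ∷ y ∷ map f (range k) ∷ʳ v) (above t≤k) ⟨
  x ∷ y ∷ map f (range k) ∷ʳ f (suc k)       ≡⟨ cong (λ vs → x ∷ y ∷ vs) (map-++ f (range k) [ suc k ]) ⟨
  x ∷ y ∷ map f (range k ∷ʳ suc k)           ≡⟨ cong (λ vs → x ∷ y ∷ map f vs) (range-∷ʳ k) ⟨
  x ∷ y ∷ map f (range (suc k))              ∎
  where open PermutationReasoning

range-shiftAt : ∀ {t} k → 1 ≤ t → t ≤ suc k → range (2 + k) ↭ t ∷ suc t ∷ map (shiftAt t) (range k)
range-shiftAt {t} k 1≤t = range-insert 1≤t shiftAt-above base k
  where
  open PermutationReasoning
  base : ∀ k → t ≡ suc k → range (2 + k) ↭ t ∷ suc t ∷ map (shiftAt t) (range k)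
  base k refl = begin
    range (2 + k)                    ≡⟨ range-∷ʳ (suc k) ⟩
    range (1 + k) ∷ʳ (2 + k)         ↭⟨ ∷↭∷ʳ (2 + k) (range (1 + k)) ⟨
    2 + k ∷ range (1 + k)            ≡⟨ cong (2 + k ∷_) (range-∷ʳ k) ⟩
    2 + k ∷ range k ∷ʳ (1 + k)       ↭⟨ ↭-prep (2 + k) (∷↭∷ʳ (1 + k) (range k)) ⟨
    2 + k ∷ 1 + k ∷ range k          ↭⟨ ↭-swap (2 + k) (1 + k) ↭-refl ⟩
    1 + k ∷ 2 + k ∷ range k          ≡⟨ cong (λ vs → 1 + k ∷ 2 + k ∷ vs) (map-id-local (All.map (λ (_ , v≤k) → shiftAt-below (s≤s v≤k)) (range-bounds k))) ⟨
    1 + k ∷ 2 + k ∷ map (shiftAt (suc k)) (range k) ∎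

range-insRenum : ∀ {t} k → 1 ≤ t → t ≤ suc k → range (2 + k) ↭ 1 ∷ suc t ∷ map (insRenum (suc t)) (range k)
range-insRenum {t} k 1≤t = range-insert 1≤t insRenum-above base k
  where
  open PermutationReasoning
  base : ∀ k → t ≡ suc k → range (2 + k) ↭ 1 ∷ suc t ∷ map (insRenum (suc t)) (range k)
  base k refl = begin
    range (2 + k)                    ≡⟨ range-∷ʳ (suc k) ⟩
    range (1 + k) ∷ʳ (2 + k)         ↭⟨ ∷↭∷ʳ (2 + k) (range (1 + k)) ⟨
    2 + k ∷ range (1 + k)            ≡⟨⟩
    2 + k ∷ 1 ∷ applyUpTo (suc ∘ suc) k ↭⟨ ↭-swap (2 + k) 1 ↭-refl ⟩
    1 ∷ 2 + k ∷ applyUpTo (suc ∘ suc) k ≡⟨ cong (λ vs → 1 ∷ 2 + k ∷ vs) (map-applyUpTo suc suc k) ⟨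
    1 ∷ 2 + k ∷ map suc (range k)    ≡⟨ cong (λ vs → 1 ∷ 2 + k ∷ vs) (map-cong-local (All.map (λ (_ , v≤k) → insRenum-below (s≤s v≤k)) (range-bounds k))) ⟨
    1 ∷ 2 + k ∷ map (insRenum (2 + k)) (range k) ∎

-- Cutting a matching at the gap and reassembling it

crossesAt : ℕ → Edge → Bool
crossesAt t e = (proj₁ e <ᵇ t) ∧ (t ≤ᵇ proj₂ e)

-- The first edge (1 , b) is kept apart even when it spans the gap, because both rewirings dissolve
-- it. `ls` and `rs` are separate lists because their ends are going to be paired anew; `Y` holds
-- the edges on one side of the gap.
record Cut (m t b : ℕ) (ls rs : List ℕ) (Y : RawMatching) : Set where
  field
    1<t      : 1 < t
    t≤1+2m   : t ≤ suc (2 * m)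
    ls-sorted : AllPairs _<_ ls
    ls<t     : All (_< t) ls
    t≤rs     : All (t ≤_) rs
    same-length : length ls ≡ length rs
    Y-split  : All (λ e → Ordered e × (proj₂ e < t ⊎ t ≤ proj₁ e)) Y
    cut-vertices : 1 ∷ b ∷ ls ++ rs ++ vertices Y ↭ range2n m

  private
    others : All (1 <_) (b ∷ ls ++ rs ++ vertices Y)
    others with All-resp-↭ (↭-sym cut-vertices) (range-bounds (2 * m))
              | Unique-resp-↭ (↭-sym cut-vertices) (range-unique (2 * m))
    ... | _ ∷ 1≤ | 1≢ ∷ _ = All.zipWith (λ ((1≤v , _) , 1≢v) → ≤∧≢⇒< 1≤v 1≢v) (1≤ , 1≢)

    b≢others : All (b ≢_) (ls ++ rs ++ vertices Y)
    b≢others with Unique-resp-↭ (↭-sym cut-vertices) (range-unique (2 * m))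
    ... | _ ∷ b≢ ∷ _ = b≢

  1<b : 1 < b
  1<b = All.head others

  1<ls : All (1 <_) ls
  1<ls = All.++⁻ˡ ls (All.tail others)

  1<Y : All (λ e → 1 < proj₁ e × 1 < proj₂ e) Y
  1<Y = All-ends (All.++⁻ʳ rs (All.++⁻ʳ ls (All.tail others)))

  b≢ls : All (b ≢_) ls
  b≢ls = All.++⁻ˡ ls b≢others

  b≢Y : All (λ e → b ≢ proj₁ e × b ≢ proj₂ e) Y
  b≢Y = All-ends (All.++⁻ʳ rs (All.++⁻ʳ ls b≢others))

not-crossing : ∀ t e → not (crossesAt t e) ≡ true → proj₂ e < t ⊎ t ≤ proj₁ e
not-crossing t (c , d) eq with c <? t | d <? t
... | _       | yes d<t = inj₁ d<t
... | no c≮t  | _       = inj₂ (≮⇒≥ c≮t)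
... | yes c<t | no d≮t  rewrite <ᵇ-true c<t | ≤ᵇ-true (≮⇒≥ d≮t) = contradiction eq (λ ())

crossing : ∀ t e → crossesAt t e ≡ true → proj₁ e < t × t ≤ proj₂ e
crossing t (c , d) eq with c <? t | d <? t
... | yes c<t | no d≮t  = c<t , ≮⇒≥ d≮t
... | no c≮t  | _       rewrite <ᵇ-false (≮⇒≥ c≮t) = contradiction eq (λ ())
... | yes c<t | yes d<t rewrite <ᵇ-true c<t | ≤ᵇ-false d<t = contradiction eq (λ ())

crossingEdges : ℕ → RawMatching → RawMatching
crossingEdges t = filterᵇ (crossesAt t)

otherEdges : ℕ → RawMatching → RawMatching
otherEdges t = filterᵇ (not ∘ crossesAt t)

cut-↭ : ∀ t b R → (1 , b) ∷ R ↭
  (1 , b) ∷ zip (map proj₁ (crossingEdges t R)) (map proj₂ (crossingEdges t R)) ++ otherEdges t R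
cut-↭ t b R rewrite zip-ends (crossingEdges t R) = ↭-prep (1 , b) (filterᵇ-partition (crossesAt t) R)

cut : ∀ m {t b R} → 1 < t → t ≤ suc (2 * m) → IsMatching m ((1 , b) ∷ R) →
  Cut m t b (map proj₁ (crossingEdges t R)) (map proj₂ (crossingEdges t R)) (otherEdges t R)
cut m {t} {b} {R} 1<t t≤ mN@(_ , _ ∷ ordered , p) = record
  { 1<t = 1<t
  ; t≤1+2m = t≤
  ; ls-sorted = AllPairs.map⁺ (AllPairs.filter⁺ (T? ∘ crossesAt t) (AllPairs.tail (sorted-lefts m mN)))
  ; ls<t = All.map⁺ (All.map (λ {e} eq → proj₁ (crossing t e eq)) X-crosses)
  ; t≤rs = All.map⁺ (All.map (λ {e} eq → proj₂ (crossing t e eq)) X-crosses)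
  ; same-length = trans (length-map proj₁ X) (sym (length-map proj₂ X))
  ; Y-split = All.zipWith (λ {e} (o , eq) → o , not-crossing t e eq)
      (All-filterᵇ (not ∘ crossesAt t) ordered , filterᵇ-satisfies (not ∘ crossesAt t) R)
  ; cut-vertices = ↭-trans (↭-prep 1 (↭-prep b (↭-sym verts))) p
  }
  where
  X Y : RawMatching
  X = crossingEdges t R
  Y = otherEdges t R

  X-crosses : All (λ e → crossesAt t e ≡ true) X
  X-crosses = filterᵇ-satisfies (crossesAt t) R

  open PermutationReasoning
  verts : vertices R ↭ map proj₁ X ++ map proj₂ X ++ vertices Y
  verts = begin
    vertices R                                    ↭⟨ vertices-↭ (filterᵇ-partition (crossesAt t) R) ⟩
    vertices (X ++ Y)                             ≡⟨ vertices-++ X Y ⟩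
    vertices X ++ vertices Y                      ↭⟨ ++⁺ʳ (vertices Y) (vertices-↭-ends X) ⟩
    (map proj₁ X ++ map proj₂ X) ++ vertices Y    ≡⟨ ++-assoc (map proj₁ X) _ _ ⟩
    map proj₁ X ++ map proj₂ X ++ vertices Y      ∎

-- `E` and `ls` are given in final positions: left ends below `t` are not moved by the shift, and
-- `t` itself is not in its image. `rs` and `Y` are still in the coordinates of the smaller
-- matching.
assemble : ℕ → List Edge → List ℕ → List ℕ → RawMatching → RawMatching
assemble t E ls rs Y = (1 , suc t) ∷ E ++ zip ls (map (shiftAt t) rs) ++ mapE (shiftAt t) Y

-- E is empty in Case 2 and consists of the edge (v₍s₊₁₎ , t) in Case 3.
record Rewired (t b : ℕ) (ls rs : List ℕ) (E : List Edge) (ls′ rs′ : List ℕ) : Set where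
  field
    E-inside   : All (λ e → 1 < proj₁ e × proj₁ e < t × proj₂ e ≡ t) E
    ls′-sorted : AllPairs _<_ ls′
    1<ls′      : All (1 <_) ls′
    ls′≤t      : All (_≤ t) ls′
    t≤rs′      : All (t ≤_) rs′
    same-length′ : length ls′ ≡ length rs′
    rewired-vertices : vertices E ++ ls′ ++ map (shiftAt t) rs′ ↭ t ∷ map (shiftAt t) (b ∷ ls ++ rs)

module _ {m t b ls rs Y E ls′ rs′} (c : Cut m t b ls rs Y) (r : Rewired t b ls rs E ls′ rs′) where
  open Cut c
  open Rewired r

  private
    sh : ℕ → ℕ
    sh = shiftAt t

    rs′-shifted : All (suc t <_) (map sh rs′)
    rs′-shifted = All.map⁺ (All.map (λ t≤v → subst (suc t <_) (sym (shiftAt-above t≤v)) (s≤s (s≤s t≤v))) t≤rs′)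

    same-length″ : length ls′ ≡ length (map sh rs′)
    same-length″ = trans same-length′ (sym (length-map sh rs′))

    matched : List Edge
    matched = zip ls′ (map sh rs′)

  assemble-ordered : All Ordered (assemble t E ls′ rs′ Y)
  assemble-ordered = s≤s (<⇒≤ 1<t) ∷
    All.++⁺ (All.map (λ (_ , a<t , eq) → subst (_ <_) (sym eq) a<t) E-inside)
   (All.++⁺ (All.map (λ (l≤t , t<r) → <-trans (s≤s l≤t) t<r) (All-zip ls′≤t rs′-shifted))
            (All.map⁺ (All.map (λ (c<d , _) → embedding-mono {sh} (shiftAt-embedding t) c<d) Y-split)))

  assemble-vertices : vertices (assemble t E ls′ rs′ Y) ↭ range2n (suc m)
  assemble-vertices = begin
    1 ∷ suc t ∷ vertices (E ++ matched ++ mapE sh Y)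
      ≡⟨ cong (λ vs → 1 ∷ suc t ∷ vs) (trans (vertices-++ E _) (cong (vertices E ++_) (vertices-++ matched _))) ⟩
    1 ∷ suc t ∷ vertices E ++ vertices matched ++ vertices (mapE sh Y)
      ↭⟨ ↭-prep 1 (↭-prep (suc t) (++⁺ˡ (vertices E) (++⁺ (vertices-zip ls′ (map sh rs′) same-length″) (↭-reflexive (vertices-mapE sh Y))))) ⟩
    1 ∷ suc t ∷ vertices E ++ (ls′ ++ map sh rs′) ++ map sh (vertices Y)
      ≡⟨ cong (λ vs → 1 ∷ suc t ∷ vs) (++-assoc (vertices E) (ls′ ++ map sh rs′) _) ⟨
    1 ∷ suc t ∷ (vertices E ++ ls′ ++ map sh rs′) ++ map sh (vertices Y)
      ↭⟨ ↭-prep 1 (↭-prep (suc t) (++⁺ʳ _ rewired-vertices)) ⟩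
    1 ∷ suc t ∷ t ∷ map sh (b ∷ ls ++ rs) ++ map sh (vertices Y)
      ≡⟨ cong (λ vs → 1 ∷ suc t ∷ t ∷ vs) (map-++ sh (b ∷ ls ++ rs) (vertices Y)) ⟨
    1 ∷ suc t ∷ t ∷ map sh (b ∷ (ls ++ rs) ++ vertices Y)
      ≡⟨ cong (λ vs → 1 ∷ suc t ∷ t ∷ map sh (b ∷ vs)) (++-assoc ls rs _) ⟩
    1 ∷ suc t ∷ t ∷ map sh (b ∷ ls ++ rs ++ vertices Y)
      ↭⟨ ↭-trans (shift t (1 ∷ suc t ∷ []) _) (↭-prep t (↭-swap 1 (suc t) ↭-refl)) ⟩
    t ∷ suc t ∷ 1 ∷ map sh (b ∷ ls ++ rs ++ vertices Y)
      -- The shift fixes 1, so the left end of the new first edge takes the place of the old vertex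
      -- 1, which the dissolved edge (1 , b) has released.
      ≡⟨ cong (λ v → t ∷ suc t ∷ v ∷ map sh (b ∷ ls ++ rs ++ vertices Y)) (shiftAt-below 1<t) ⟨
    t ∷ suc t ∷ map sh (1 ∷ b ∷ ls ++ rs ++ vertices Y)
      ↭⟨ ↭-prep t (↭-prep (suc t) (map⁺ sh cut-vertices)) ⟩
    t ∷ suc t ∷ map sh (range2n m)
      ↭⟨ range-shiftAt (2 * m) (<⇒≤ 1<t) t≤1+2m ⟨
    range (2 + 2 * m)
      ≡⟨ cong range (*-suc 2 m) ⟨
    range2n (suc m) ∎
    where open PermutationReasoning

slots : ℕ → List ℕ → List ℕ
slots b ls = insertℕ b ls

-- The number s of Case 3. Positions in `slots` count from 0, so index s selects v₍s₊₁₎.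
freedIndex : ℕ → List ℕ → ℕ
freedIndex b ls = count (b <ᵇ_) ls

freed : ℕ → List ℕ → ℕ
freed b ls = nthOr 0 (slots b ls) (freedIndex b ls)

kept : ℕ → List ℕ → List ℕ
kept b ls = removeNth (slots b ls) (freedIndex b ls)

slots-length : ∀ b ls → length (slots b ls) ≡ suc (length ls)
slots-length b ls = ↭-length (insertℕ-↭ b ls)

freedIndex-< : ∀ b ls → freedIndex b ls < length (slots b ls)
freedIndex-< b ls = subst (freedIndex b ls <_) (sym (slots-length b ls)) (s≤s (length-filter (T? ∘ (b <ᵇ_)) ls))

freed-kept-↭ : ∀ b ls → b ∷ ls ↭ freed b ls ∷ kept b ls
freed-kept-↭ b ls = ↭-trans (↭-sym (insertℕ-↭ b ls)) (nthOr-↭ 0 (slots b ls) (freedIndex-< b ls))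

module _ {m t b ls rs Y} (c : Cut m t b ls rs Y) where
  open Cut c

  private
    sh : ℕ → ℕ
    sh = shiftAt t

    map-sh-ls : map sh ls ≡ ls
    map-sh-ls = map-id-local (All.map shiftAt-below ls<t)

  slots-sorted : AllPairs _<_ (slots b ls)
  slots-sorted = insertℕ-sorted b ls-sorted b≢ls

  -- The edges across the gap were `zip (1 ∷ ls) (b ∷ rs)`. Dropping 1 and appending `t` on the left
  -- hands every right end to the next left end.
  rewired-crossed : t ≤ b → Rewired t b ls rs [] (ls ∷ʳ t) (b ∷ rs)
  rewired-crossed t≤b = record
    { E-inside = []
    ; ls′-sorted = AllPairs.++⁺ ls-sorted ([] ∷ []) (All.map (_∷ []) ls<t)
    ; 1<ls′ = All.++⁺ 1<ls (1<t ∷ [])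
    ; ls′≤t = All.++⁺ (All.map <⇒≤ ls<t) (≤-refl ∷ [])
    ; t≤rs′ = t≤b ∷ t≤rs
    ; same-length′ = trans (length-++ ls) (trans (+-comm (length ls) 1) (cong suc same-length))
    ; rewired-vertices = begin
        (ls ∷ʳ t) ++ map sh (b ∷ rs)          ↭⟨ ++⁺ʳ _ (∷↭∷ʳ t ls) ⟨
        t ∷ ls ++ sh b ∷ map sh rs            ↭⟨ ↭-prep t (shift (sh b) ls (map sh rs)) ⟩
        t ∷ sh b ∷ ls ++ map sh rs            ≡⟨ cong (λ vs → t ∷ sh b ∷ vs ++ map sh rs) map-sh-ls ⟨
        t ∷ sh b ∷ map sh ls ++ map sh rs     ≡⟨ cong (λ vs → t ∷ sh b ∷ vs) (map-++ sh ls rs) ⟨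
        t ∷ map sh (b ∷ ls ++ rs)             ∎
    }
    where open PermutationReasoning

  -- Here `b` turns from a right end into a left end. Together with `ls` this makes one slot more
  -- than there are right ends in `rs`, and the surplus slot is joined to `t`.
  rewired-nested : b < t → Rewired t b ls rs [ (freed b ls , t) ] (kept b ls) rs
  rewired-nested b<t = record
    { E-inside = (All.head 1<slots , All.head slots<t , refl) ∷ []
    ; ls′-sorted = removeNth-sorted (freedIndex b ls) slots-sorted
    ; 1<ls′ = All.tail 1<slots
    ; ls′≤t = All.map <⇒≤ (All.tail slots<t)
    ; t≤rs′ = t≤rs
    ; same-length′ = trans (suc-injective (sym (↭-length (freed-kept-↭ b ls)))) same-length
    ; rewired-vertices = begin
        v ∷ t ∷ kept b ls ++ map sh rs        ↭⟨ ↭-swap v t ↭-refl ⟩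
        t ∷ v ∷ kept b ls ++ map sh rs        ↭⟨ ↭-prep t (++⁺ʳ (map sh rs) (freed-kept-↭ b ls)) ⟨
        t ∷ b ∷ ls ++ map sh rs               ≡⟨ cong₂ (λ w vs → t ∷ w ∷ vs ++ map sh rs) (shiftAt-below b<t) map-sh-ls ⟨
        t ∷ sh b ∷ map sh ls ++ map sh rs     ≡⟨ cong (λ vs → t ∷ sh b ∷ vs) (map-++ sh ls rs) ⟨
        t ∷ map sh (b ∷ ls ++ rs)             ∎
    }
    where
    open PermutationReasoning
    v : ℕ
    v = freed b ls

    slots<t : All (_< t) (v ∷ kept b ls)
    slots<t = All-resp-↭ (freed-kept-↭ b ls) (b<t ∷ ls<t)

    1<slots : All (1 <_) (v ∷ kept b ls)
    1<slots = All-resp-↭ (freed-kept-↭ b ls) (1<b ∷ 1<ls)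

-- Nestings, and how rewiring changes their number

nested : Edge → Edge → ℕ
nested e f = ⟦ nestedᵇ e f ⟧

nested-comm : ∀ e f → nested e f ≡ nested f e
nested-comm e f = cong ⟦_⟧ (∨-comm ((proj₁ e <ᵇ proj₁ f) ∧ (proj₂ f <ᵇ proj₂ e)) _)

nested-by-rights : ∀ {e f} → e <ₗ f → nested e f ≡ ⟦ proj₂ f <ᵇ proj₂ e ⟧
nested-by-rights e<f rewrite <ᵇ-true e<f | <ᵇ-false (<⇒≤ e<f) = cong ⟦_⟧ (∨-identityʳ _)

nested-by-lefts : ∀ {e f} → proj₂ f < proj₂ e → nested e f ≡ ⟦ proj₁ e <ᵇ proj₁ f ⟧
nested-by-lefts {e} {f} f<e rewrite <ᵇ-true f<e | <ᵇ-false (<⇒≤ f<e) =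
  cong ⟦_⟧ (trans (cong₂ _∨_ (∧-identityʳ _) (∧-zeroʳ (proj₁ f <ᵇ proj₁ e))) (∨-identityʳ _))

nestedᵇ-map : ∀ {g} → Embedding g → ∀ a b c d → nestedᵇ (g a , g b) (g c , g d) ≡ nestedᵇ (a , b) (c , d)
nestedᵇ-map emb a b c d rewrite emb a c | emb d b | emb c a | emb b d = refl

ne-∷ : ∀ e L → ne (e ∷ L) ≡ total (nested e) L + ne L
ne-∷ e L = cong (_+ ne L) (count-total (nestedᵇ e) L)

ne-↭ : ∀ {L L′} → L ↭ L′ → ne L ≡ ne L′
ne-↭ Perm.refl = refl
ne-↭ (Perm.prep e p) = cong₂ _+_ (count-↭ (nestedᵇ e) p) (ne-↭ p)
ne-↭ {e ∷ f ∷ L} {f ∷ e ∷ L′} (Perm.swap e f p)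
  rewrite ne-∷ e (f ∷ L) | ne-∷ f L | ne-∷ f (e ∷ L′) | ne-∷ e L′ | nested-comm e f
        | total-↭ (nested e) p | total-↭ (nested f) p | ne-↭ p =
  solve 4 (λ x a b c → (x :+ a) :+ (b :+ c) := (x :+ b) :+ (a :+ c)) refl
    (nested f e) (total (nested e) L′) (total (nested f) L′) (ne L′)
ne-↭ (Perm.trans p q) = trans (ne-↭ p) (ne-↭ q)

nestedWith : List Edge → Edge → ℕ
nestedWith P y = total (λ p → nested p y) P

ne-++ : ∀ P Q → ne (P ++ Q) ≡ ne P + ne Q + total (nestedWith P) Q
ne-++ [] Q = sym (trans (cong (ne Q +_) (total-zero (All.universal (λ _ → refl) Q))) (+-identityʳ (ne Q)))
ne-++ (p ∷ P) Q rewrite ne-∷ p (P ++ Q) | ne-∷ p P | ne-++ P Q | total-++ (nested p) P Q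
                      | total-+ (nested p) (nestedWith P) Q =
  solve 5 (λ a b c d e → (a :+ b) :+ (c :+ d :+ e) := (a :+ c) :+ d :+ (b :+ e)) refl
    (total (nested p) P) (total (nested p) Q) (ne P) (ne Q) (total (nestedWith P) Q)

ne-mapE : ∀ {g} → Embedding g → ∀ L → ne (mapE g L) ≡ ne L
ne-mapE emb [] = refl
ne-mapE {g} emb (e ∷ L) rewrite ne-∷ (g (proj₁ e) , g (proj₂ e)) (mapE g L) | ne-∷ e L =
  cong₂ _+_ (trans (total-map _ _ L) (total-cong (All.universal (λ f → cong ⟦_⟧ (nestedᵇ-map {g} emb (proj₁ e) (proj₂ e) (proj₁ f) (proj₂ f))) L))) (ne-mapE {g} emb L)

total-zip-left : ∀ {f : Edge → ℕ} {g : ℕ → ℕ} ls rs → length ls ≡ length rs →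
  All (λ e → f e ≡ g (proj₁ e)) (zip ls rs) → total f (zip ls rs) ≡ total g ls
total-zip-left {f} {g} ls rs len eqs = trans (total-cong eqs)
  (trans (sym (total-map g proj₁ (zip ls rs))) (cong (total g) (lefts-zip ls rs len)))

total-zip-right : ∀ {f : Edge → ℕ} {g : ℕ → ℕ} ls rs → length ls ≡ length rs →
  All (λ e → f e ≡ g (proj₂ e)) (zip ls rs) → total f (zip ls rs) ≡ total g rs
total-zip-right {f} {g} ls rs len eqs = trans (total-cong eqs)
  (trans (sym (total-map g proj₂ (zip ls rs))) (cong (total g) (rights-zip ls rs len)))

inversions : List ℕ → ℕ
inversions []       = 0
inversions (r ∷ rs) = total (λ x → ⟦ x <ᵇ r ⟧) rs + inversions rs

inversions-map : ∀ {g} → Embedding g → ∀ rs → inversions (map g rs) ≡ inversions rs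
inversions-map emb [] = refl
inversions-map {g} emb (r ∷ rs) = cong₂ _+_
  (trans (total-map _ g rs) (total-cong (All.universal (λ x → cong ⟦_⟧ (emb x r)) rs)))
  (inversions-map {g} emb rs)

All-zip-left : ∀ {P : ℕ → Set} {ls} → All P ls → ∀ rs → All (λ (e : Edge) → P (proj₁ e)) (zip ls rs)
All-zip-left []       _        = []
All-zip-left (_ ∷ _)  []       = []
All-zip-left (p ∷ ps) (_ ∷ rs) = p ∷ All-zip-left ps rs

All-zip-right : ∀ {P : ℕ → Set} ls {rs} → All P rs → All (λ (e : Edge) → P (proj₂ e)) (zip ls rs)
All-zip-right []       _        = []
All-zip-right (_ ∷ _)  []       = []
All-zip-right (_ ∷ ls) (p ∷ ps) = p ∷ All-zip-right ls ps

-- Of two edges listed by increasing left ends the later can only be the inner one, so being nested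
-- means that the right ends are inverted; the values of the left ends drop out.
ne-zip : ∀ {ls} rs → AllPairs _<_ ls → length ls ≡ length rs → ne (zip ls rs) ≡ inversions rs
ne-zip [] [] _ = refl
ne-zip {l ∷ ls} (r ∷ rs) (l< ∷ s) len = trans (ne-∷ (l , r) (zip ls rs)) (cong₂ _+_
  (total-zip-right ls rs (suc-injective len) (All.map (λ {e} → nested-by-rights {l , r} {e}) (All-zip-left l< rs)))
  (ne-zip rs s (suc-injective len)))

-- All right ends lie beyond y, so only left ends are compared. The resulting sum is invariant under
-- permutations of `ls`, which makes it insensitive to rewiring. `nestedWith-outer` is the
-- counterpart for y above the gap.
nestedWith-inner : ∀ ls {rs} y → length ls ≡ length rs → All (proj₂ y <_) rs →
  nestedWith (zip ls rs) y ≡ total (λ l → ⟦ l <ᵇ proj₁ y ⟧) ls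
nestedWith-inner ls {rs} y len y<rs =
  total-zip-left ls rs len (All.map (λ {e} → nested-by-lefts {e} {y}) (All-zip-right ls y<rs))

nestedWith-outer : ∀ {ls rs} y → length ls ≡ length rs → All (_< proj₁ y) ls →
  nestedWith (zip ls rs) y ≡ total (λ r → ⟦ proj₂ y <ᵇ r ⟧) rs
nestedWith-outer {ls} {rs} y len ls<y =
  total-zip-right ls rs len (All.map (λ {e} → nested-by-rights {e} {y}) (All-zip-left ls<y rs))

total-vertices : ∀ (f : ℕ → ℕ) L → total f (vertices L) ≡ total (λ e → f (proj₁ e) + f (proj₂ e)) L
total-vertices f [] = refl
total-vertices f (e ∷ L) rewrite total-vertices f L = sym (+-assoc (f (proj₁ e)) _ _)

-- The window of st₁ read in the smaller matching. It is half-open although `st` tests with `≤` on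
-- both sides, because the upper bound `suc t` is the right end of the first edge and no renumbered
-- vertex lands on it.
between : ℕ → ℕ → ℕ → Bool
between b t v = (b ≤ᵇ v) ∧ (v <ᵇ t)

between-true : ∀ {b t v} → b ≤ v → v < t → between b t v ≡ true
between-true b≤v v<t rewrite ≤ᵇ-true b≤v = <ᵇ-true v<t

between-low : ∀ t {b v} → v < b → between b t v ≡ false
between-low t v<b rewrite ≤ᵇ-false v<b = refl

between-high : ∀ {b t v} → t ≤ v → between b t v ≡ false
between-high {b} {t} {v} t≤v = trans (cong ((b ≤ᵇ v) ∧_) (<ᵇ-false t≤v)) (∧-zeroʳ (b ≤ᵇ v))

module _ {m t b ls rs Y} (c : Cut m t b ls rs Y) where
  open Cut c

  private
    sh : ℕ → ℕ
    sh = shiftAt t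

    shE : Edge → Edge
    shE e = sh (proj₁ e) , sh (proj₂ e)

    suc-t<sh : ∀ {v} → t ≤ v → suc t < sh v
    suc-t<sh t≤v = subst (suc t <_) (sym (shiftAt-above {t} t≤v)) (s≤s (s≤s t≤v))

    <ᵇ-sh-suc : ∀ v → (sh v <ᵇ suc t) ≡ (v <ᵇ t)
    <ᵇ-sh-suc v with v <? t
    ... | yes v<t rewrite shiftAt-below v<t | <ᵇ-true v<t = <ᵇ-true (m<n⇒m<1+n v<t)
    ... | no v≮t rewrite shiftAt-above (≮⇒≥ v≮t) | <ᵇ-false (≮⇒≥ v≮t) = <ᵇ-false (m≤n⇒m≤1+n (≮⇒≥ v≮t))

  module _ {E ls′ rs′} (r : Rewired t b ls rs E ls′ rs′) where
    open Rewired r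

    private
      matched : List Edge
      matched = zip ls′ (map sh rs′)

      same-length″ : length ls′ ≡ length (map sh rs′)
      same-length″ = trans same-length′ (sym (length-map sh rs′))

    shifted-rights : All (suc t <_) (map sh rs′)
    shifted-rights = All.map⁺ (All.map suc-t<sh t≤rs′)

    -- Edges across the gap end beyond `suc t`, so only edges wholly below the gap are nested in the
    -- new first edge.
    nests-in-first : total (nested (1 , suc t)) (matched ++ mapE sh Y) ≡ total (λ y → ⟦ proj₂ y <ᵇ t ⟧) Y
    nests-in-first = trans (total-++ (nested (1 , suc t)) matched (mapE sh Y)) (cong₂ _+_
      (total-zero (All.map (λ {e} (1<l , t<r) → trans (nested-by-rights {1 , suc t} {e} 1<l) (cong ⟦_⟧ (<ᵇ-false (<⇒≤ t<r))))
        (All-zip 1<ls′ shifted-rights)))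
      (trans (total-map (nested (1 , suc t)) shE Y) (total-cong (All.map
        (λ {e} (1<c , _) → trans (nested-by-rights {1 , suc t} {shE e} (1<sh 1<c)) (cong ⟦_⟧ (<ᵇ-sh-suc (proj₂ e)))) 1<Y))))
      where
      1<sh : ∀ {v} → 1 < v → 1 < sh v
      1<sh {v} 1<v = subst (_< sh v) (shiftAt-below {t} 1<t) (embedding-mono {sh} (shiftAt-embedding t) 1<v)

    ne-matched-others : ne (matched ++ mapE sh Y) ≡ inversions rs′ + ne Y + total (nestedWith matched ∘ shE) Y
    ne-matched-others = trans (ne-++ matched (mapE sh Y)) (cong₂ _+_
      (cong₂ _+_ (trans (ne-zip (map sh rs′) ls′-sorted same-length″) (inversions-map {sh} (shiftAt-embedding t) rs′))
                 (ne-mapE {sh} (shiftAt-embedding t) Y))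
      (total-map (nestedWith matched) shE Y))

    matched-inner : ∀ y → proj₂ y < t → Ordered y → nestedWith matched (shE y) ≡ total (λ l → ⟦ l <ᵇ proj₁ y ⟧) ls′
    matched-inner y d<t c<d rewrite shiftAt-below d<t | shiftAt-below (<-trans c<d d<t) =
      nestedWith-inner ls′ y same-length″ (All.map (<-trans (m<n⇒m<1+n d<t)) shifted-rights)

    matched-outer : ∀ y → t ≤ proj₁ y → nestedWith matched (shE y) ≡ total (λ r → ⟦ proj₂ y <ᵇ r ⟧) rs′
    matched-outer y t≤c = trans
      (nestedWith-outer (shE y) same-length″ (All.map (λ l≤t → ≤-<-trans l≤t (<-trans ≤-refl (suc-t<sh t≤c))) ls′≤t))
      (trans (total-map _ sh rs′) (total-cong (All.universal (λ r → cong ⟦_⟧ (shiftAt-embedding t (proj₂ y) r)) rs′)))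

  -- An edge below the gap was nested in (1 , b); now it is nested in (1 , `suc t`) instead, and the
  -- additional left end `t` lies to its right and contributes nothing. An edge above the gap
  -- compares only with right ends, which are the same as before, and so is their order.
  ne-crossed : t ≤ b → ne (assemble t [] (ls ∷ʳ t) (b ∷ rs) Y) ≡ ne ((1 , b) ∷ zip ls rs ++ Y)
  ne-crossed t≤b = begin
    ne (assemble t [] (ls ∷ʳ t) (b ∷ rs) Y)
      ≡⟨ ne-∷ (1 , suc t) (matched ++ mapE sh Y) ⟩
    total (nested (1 , suc t)) (matched ++ mapE sh Y) + ne (matched ++ mapE sh Y)
      ≡⟨ cong₂ _+_ (nests-in-first r) (ne-matched-others r) ⟩
    total inner Y + (inversions (b ∷ rs) + ne Y + total (nestedWith matched ∘ shE) Y)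
      ≡⟨ solve 3 (λ x y z → x :+ (y :+ z) := y :+ (x :+ z)) refl (total inner Y) (inversions (b ∷ rs) + ne Y) _ ⟩
    inversions (b ∷ rs) + ne Y + (total inner Y + total (nestedWith matched ∘ shE) Y)
      ≡⟨ cong (inversions (b ∷ rs) + ne Y +_) (total-+ inner (nestedWith matched ∘ shE) Y) ⟨
    inversions (b ∷ rs) + ne Y + total (λ y → inner y + nestedWith matched (shE y)) Y
      ≡⟨ cong (inversions (b ∷ rs) + ne Y +_) (total-cong (All.zipWith (λ {y} → pointwise y) (Y-split , 1<Y))) ⟩
    inversions (b ∷ rs) + ne Y + total (nestedWith old) Y
      ≡⟨ cong (λ x → x + ne Y + total (nestedWith old) Y) (ne-zip (b ∷ rs) (1<ls ∷ ls-sorted) (cong suc same-length)) ⟨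
    ne old + ne Y + total (nestedWith old) Y
      ≡⟨ ne-++ old Y ⟨
    ne ((1 , b) ∷ zip ls rs ++ Y) ∎
    where
    open ≡-Reasoning
    r : Rewired t b ls rs [] (ls ∷ʳ t) (b ∷ rs)
    r = rewired-crossed c t≤b

    old matched : List Edge
    old = zip (1 ∷ ls) (b ∷ rs)
    matched = zip (ls ∷ʳ t) (map sh (b ∷ rs))

    inner : Edge → ℕ
    inner y = ⟦ proj₂ y <ᵇ t ⟧

    pointwise : ∀ y → (Ordered y × (proj₂ y < t ⊎ t ≤ proj₁ y)) × (1 < proj₁ y × 1 < proj₂ y) →
      inner y + nestedWith matched (shE y) ≡ nestedWith old y
    pointwise y ((c<d , inj₁ d<t) , (1<c , _)) = begin
      inner y + nestedWith matched (shE y)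
        ≡⟨ cong₂ _+_ (cong ⟦_⟧ (<ᵇ-true d<t)) (matched-inner r y d<t c<d) ⟩
      1 + total below (ls ∷ʳ t)
        ≡⟨ cong suc (total-++ below ls [ t ]) ⟩
      1 + (total below ls + (below t + 0))
        ≡⟨ cong (λ x → 1 + (total below ls + (x + 0))) (cong ⟦_⟧ (<ᵇ-false (<⇒≤ (<-trans c<d d<t)))) ⟩
      1 + (total below ls + 0)
        ≡⟨ cong suc (+-identityʳ _) ⟩
      1 + total below ls
        ≡⟨ cong (_+ total below ls) (cong ⟦_⟧ (<ᵇ-true 1<c)) ⟨
      total below (1 ∷ ls)
        ≡⟨ nestedWith-inner (1 ∷ ls) y (cong suc same-length) (<-≤-trans d<t t≤b ∷ All.map (<-≤-trans d<t) t≤rs) ⟨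
      nestedWith old y ∎
      where
      below : ℕ → ℕ
      below l = ⟦ l <ᵇ proj₁ y ⟧
    pointwise y ((c<d , inj₂ t≤c) , (1<c , _)) = trans
      (cong₂ _+_ (cong ⟦_⟧ (<ᵇ-false (<⇒≤ (≤-<-trans t≤c c<d)))) (matched-outer r y t≤c))
      (sym (nestedWith-outer y (cong suc same-length) (1<c ∷ All.map (λ l<t → <-≤-trans l<t t≤c) ls<t)))

  -- Exactly s entries of the sorted slots precede the one at index s, and all of them are kept. The
  -- right-hand side counts the rewired edges around (`freed b ls` , t); it also recovers s from
  -- data visible in the image.
  freedIndex-count : freedIndex b ls ≡ total (λ l → ⟦ l <ᵇ freed b ls ⟧) (kept b ls)
  freedIndex-count = begin
    freedIndex b ls                                  ≡⟨ count-below-nth 0 (slots-sorted c) (freedIndex-< b ls) ⟨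
    count (_<ᵇ v) (slots b ls)                       ≡⟨ count-total (_<ᵇ v) (slots b ls) ⟩
    total below (slots b ls)                         ≡⟨ total-↭ below (nthOr-↭ 0 (slots b ls) (freedIndex-< b ls)) ⟩
    below v + total below (kept b ls)                ≡⟨ cong (_+ total below (kept b ls)) (cong ⟦_⟧ (<ᵇ-false (≤-refl {v}))) ⟩
    total below (kept b ls)                          ∎
    where
    open ≡-Reasoning
    v : ℕ
    v = freed b ls
    below : ℕ → ℕ
    below l = ⟦ l <ᵇ v ⟧

  -- Sorts the vertices of the window by origin: `b` itself, the left ends across the gap that
  -- exceed `b`, and the ends of the remaining edges. Vertex 1 lies below the window and `rs` above
  -- it.
  between-count : b < t → count (between b t) (range2n m) ≡
    suc (freedIndex b ls + total (λ y → ⟦ between b t (proj₁ y) ⟧ + ⟦ between b t (proj₂ y) ⟧) Y)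
  between-count b<t = begin
    count (between b t) (range2n m)
      ≡⟨ count-↭ (between b t) cut-vertices ⟨
    count (between b t) (1 ∷ b ∷ ls ++ rs ++ vertices Y)
      ≡⟨ count-total (between b t) (1 ∷ b ∷ ls ++ rs ++ vertices Y) ⟩
    w 1 + (w b + total w (ls ++ rs ++ vertices Y))
      ≡⟨ cong₂ (λ x y → x + (y + total w (ls ++ rs ++ vertices Y)))
           (cong ⟦_⟧ (between-low t 1<b)) (cong ⟦_⟧ (between-true (≤-refl {b}) b<t)) ⟩
    suc (total w (ls ++ rs ++ vertices Y))
      ≡⟨ cong suc (trans (total-++ w ls _) (cong (total w ls +_) (total-++ w rs _))) ⟩
    suc (total w ls + (total w rs + total w (vertices Y)))
      ≡⟨ cong suc (cong₂ _+_ lefts (cong₂ _+_ (total-zero (All.map (cong ⟦_⟧ ∘ between-high {b}) t≤rs)) (total-vertices w Y))) ⟩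
    suc (freedIndex b ls + total (λ y → w (proj₁ y) + w (proj₂ y)) Y) ∎
    where
    open ≡-Reasoning
    w : ℕ → ℕ
    w v = ⟦ between b t v ⟧
    lefts : total w ls ≡ freedIndex b ls
    lefts = trans (total-cong (All.zipWith (λ (l<t , b≢l) → cong ⟦_⟧ (left l<t b≢l)) (ls<t , b≢ls)))
                  (sym (count-total (b <ᵇ_) ls))
      where
      left : ∀ {l} → l < t → b ≢ l → between b t l ≡ (b <ᵇ l)
      left {l} l<t b≢l with <-cmp b l
      ... | tri< b<l _ _ = trans (between-true (<⇒≤ b<l) l<t) (sym (<ᵇ-true b<l))
      ... | tri≈ _ eq _  = contradiction eq b≢l
      ... | tri> _ _ l<b = trans (between-low t l<b) (sym (<ᵇ-false (<⇒≤ l<b)))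

  -- Each term of `between-count` pays for new nestings: 1 for the closing edge inside the new first
  -- edge, s for the rewired edges around the closing edge, and the ends of the remaining edges for
  -- what these edges gain themselves.
  ne-nested : b < t → ne (assemble t [ (freed b ls , t) ] (kept b ls) rs Y) ≡
    count (between b t) (range2n m) + ne ((1 , b) ∷ zip ls rs ++ Y)
  ne-nested b<t = begin
    ne ((1 , suc t) ∷ (v , t) ∷ matched ++ mapE sh Y)
      ≡⟨ trans (ne-∷ (1 , suc t) ((v , t) ∷ matched ++ mapE sh Y)) (cong (total (nested (1 , suc t)) ((v , t) ∷ matched ++ mapE sh Y) +_) (ne-∷ (v , t) (matched ++ mapE sh Y))) ⟩
    nested (1 , suc t) (v , t) + total (nested (1 , suc t)) (matched ++ mapE sh Y)
      + (total (nested (v , t)) (matched ++ mapE sh Y) + ne (matched ++ mapE sh Y))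
      ≡⟨ cong₂ (λ x y → x + y) (cong₂ _+_ first-nests (nests-in-first r)) (cong₂ _+_ freed-nests (ne-matched-others r)) ⟩
    1 + total inner Y + (s + total onFreed Y + (inversions rs + ne Y + total (nestedWith matched ∘ shE) Y))
      ≡⟨ solve 6 (λ a x c d e g → con 1 :+ a :+ (x :+ c :+ (d :+ e :+ g)) := con 1 :+ x :+ (d :+ e) :+ (a :+ (c :+ g))) refl
           (total inner Y) s (total onFreed Y) (inversions rs) (ne Y) _ ⟩
    1 + s + (inversions rs + ne Y) + (total inner Y + (total onFreed Y + total (nestedWith matched ∘ shE) Y))
      ≡⟨ cong (1 + s + (inversions rs + ne Y) +_) sums ⟩
    1 + s + (inversions rs + ne Y) + (total (nested (1 , b)) Y + (total (nestedWith old) Y + total hits Y))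
      ≡⟨ solve 6 (λ x d e a c g → con 1 :+ x :+ (d :+ e) :+ (a :+ (c :+ g)) := con 1 :+ (x :+ g) :+ (a :+ (d :+ e :+ c))) refl
           s (inversions rs) (ne Y) (total (nested (1 , b)) Y) _ _ ⟩
    suc (s + total hits Y) + (total (nested (1 , b)) Y + (inversions rs + ne Y + total (nestedWith old) Y))
      ≡⟨ cong₂ _+_ (sym (between-count b<t)) (cong₂ _+_ (sym old-first) (cong (λ x → x + ne Y + total (nestedWith old) Y) (sym (ne-zip rs ls-sorted same-length)))) ⟩
    count (between b t) (range2n m) + (total (nested (1 , b)) (old ++ Y) + (ne old + ne Y + total (nestedWith old) Y))
      ≡⟨ cong (count (between b t) (range2n m) +_) (trans (ne-∷ (1 , b) (old ++ Y)) (cong (total (nested (1 , b)) (old ++ Y) +_) (ne-++ old Y))) ⟨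
    count (between b t) (range2n m) + ne ((1 , b) ∷ old ++ Y) ∎
    where
    open ≡-Reasoning
    r : Rewired t b ls rs [ (freed b ls , t) ] (kept b ls) rs
    r = rewired-nested c b<t

    v s : ℕ
    v = freed b ls
    s = freedIndex b ls

    old matched : List Edge
    old = zip ls rs
    matched = zip (kept b ls) (map sh rs)

    inner onFreed hits : Edge → ℕ
    inner y = ⟦ proj₂ y <ᵇ t ⟧
    onFreed y = nested (v , t) (shE y)
    hits y = ⟦ between b t (proj₁ y) ⟧ + ⟦ between b t (proj₂ y) ⟧

    v-bounds : 1 < v × v < t
    v-bounds with Rewired.E-inside r
    ... | (1<v , v<t , _) ∷ [] = 1<v , v<t

    first-nests : nested (1 , suc t) (v , t) ≡ 1
    first-nests = trans (nested-by-rights {1 , suc t} {v , t} (proj₁ v-bounds)) (cong ⟦_⟧ (<ᵇ-true (≤-refl {suc t})))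

    freed-nests : total (nested (v , t)) (matched ++ mapE sh Y) ≡ s + total onFreed Y
    freed-nests = trans (total-++ (nested (v , t)) matched _) (cong₂ _+_
      (trans (total-cong (All.universal (nested-comm (v , t)) matched))
        (trans (nestedWith-inner (kept b ls) (v , t) (trans (Rewired.same-length′ r) (sym (length-map sh rs)))
                 (All.map (<-trans ≤-refl) (shifted-rights r)))
               (sym freedIndex-count)))
      (total-map (nested (v , t)) shE Y))

    old-first : total (nested (1 , b)) (old ++ Y) ≡ total (nested (1 , b)) Y
    old-first = trans (total-++ (nested (1 , b)) old Y) (cong (_+ total (nested (1 , b)) Y)
      (total-zero (All.map (λ {e} (1<l , t≤r) → trans (nested-by-rights {1 , b} {e} 1<l) (cong ⟦_⟧ (<ᵇ-false (<⇒≤ (<-≤-trans b<t t≤r)))))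
        (All-zip 1<ls t≤rs))))

    -- For y below the gap the freed slot counts like a kept one, since its edge closes at `t`,
    -- beyond y; freed and kept slots together are `b ∷ ls`. The excess over the old count is one
    -- per end of y in the window: for the right end, because y is now inside the first edge even
    -- where it was not inside (1 , b); for the left end, because `b` has become a left end. Above
    -- the gap only right ends matter and nothing changes.
    pointwise : ∀ y → (Ordered y × (proj₂ y < t ⊎ t ≤ proj₁ y)) × ((1 < proj₁ y × 1 < proj₂ y) × (b ≢ proj₁ y × b ≢ proj₂ y)) →
      inner y + (onFreed y + nestedWith matched (shE y)) ≡ nested (1 , b) y + (nestedWith old y + hits y)
    pointwise y@(c′ , d) ((c<d , inj₁ d<t) , ((1<c , _) , (b≢c , b≢d))) = begin
      inner y + (onFreed y + nestedWith matched (shE y))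
        ≡⟨ cong₂ (λ x z → x + z) (cong ⟦_⟧ (<ᵇ-true d<t)) (cong₂ _+_ onFreed-inner (matched-inner r y d<t c<d)) ⟩
      1 + (below v + total below (kept b ls))
        ≡⟨ cong suc (total-↭ below (freed-kept-↭ b ls)) ⟨
      1 + (below b + total below ls)
        ≡⟨ cong (_+ (below b + total below ls)) right ⟨
      (⟦ d <ᵇ b ⟧ + ⟦ between b t d ⟧) + (below b + total below ls)
        ≡⟨ solve 4 (λ x z w u → (x :+ z) :+ (w :+ u) := x :+ (u :+ (w :+ z))) refl ⟦ d <ᵇ b ⟧ ⟦ between b t d ⟧ (below b) (total below ls) ⟩
      ⟦ d <ᵇ b ⟧ + (total below ls + (below b + ⟦ between b t d ⟧))
        ≡⟨ cong₂ (λ x z → x + z) (nested-by-rights {1 , b} {y} 1<c) (cong₂ _+_ (nestedWith-inner ls y same-length (All.map (<-≤-trans d<t) t≤rs)) (cong (_+ ⟦ between b t d ⟧) left)) ⟨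
      nested (1 , b) y + (nestedWith old y + hits y) ∎
      where
      below : ℕ → ℕ
      below l = ⟦ l <ᵇ c′ ⟧

      onFreed-inner : onFreed y ≡ below v
      onFreed-inner rewrite shiftAt-below d<t | shiftAt-below (<-trans c<d d<t) = nested-by-lefts {v , t} {y} d<t

      right : ⟦ d <ᵇ b ⟧ + ⟦ between b t d ⟧ ≡ 1
      right with <-cmp b d
      ... | tri< b<d _ _ rewrite <ᵇ-false (<⇒≤ b<d) | between-true (<⇒≤ b<d) d<t = refl
      ... | tri≈ _ eq _  = contradiction eq b≢d
      ... | tri> _ _ d<b rewrite <ᵇ-true d<b | between-low t d<b = refl

      left : ⟦ between b t c′ ⟧ ≡ below b
      left with <-cmp b c′
      ... | tri< b<c _ _ = cong ⟦_⟧ (trans (between-true (<⇒≤ b<c) (<-trans c<d d<t)) (sym (<ᵇ-true b<c)))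
      ... | tri≈ _ eq _  = contradiction eq b≢c
      ... | tri> _ _ c<b = cong ⟦_⟧ (trans (between-low t c<b) (sym (<ᵇ-false (<⇒≤ c<b))))
    pointwise y@(c′ , d) ((c<d , inj₂ t≤c) , ((1<c , _) , _)) = begin
      inner y + (onFreed y + nestedWith matched (shE y))
        ≡⟨ cong₂ (λ x z → x + (z + nestedWith matched (shE y))) (cong ⟦_⟧ (<ᵇ-false (<⇒≤ t<d))) onFreed-outer ⟩
      nestedWith matched (shE y)
        ≡⟨ matched-outer r y t≤c ⟩
      total (λ r → ⟦ d <ᵇ r ⟧) rs
        ≡⟨ nestedWith-outer y same-length (All.map (λ l<t → <-≤-trans l<t t≤c) ls<t) ⟨
      nestedWith old y
        ≡⟨ +-identityʳ _ ⟨
      nestedWith old y + 0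
        ≡⟨ cong₂ (λ x z → x + (nestedWith old y + z)) not-nested (cong₂ _+_ (cong ⟦_⟧ (between-high {b} t≤c)) (cong ⟦_⟧ (between-high {b} (<⇒≤ t<d)))) ⟨
      nested (1 , b) y + (nestedWith old y + hits y) ∎
      where
      t<d : t < d
      t<d = ≤-<-trans t≤c c<d

      not-nested : nested (1 , b) y ≡ 0
      not-nested = trans (nested-by-rights {1 , b} {y} 1<c) (cong ⟦_⟧ (<ᵇ-false (<⇒≤ (<-trans b<t t<d))))

      onFreed-outer : onFreed y ≡ 0
      onFreed-outer = trans (nested-by-rights {v , t} {shE y} (<-trans (proj₂ v-bounds) (<-trans ≤-refl (suc-t<sh t≤c))))
        (cong ⟦_⟧ (<ᵇ-false (<⇒≤ (<-trans ≤-refl (suc-t<sh (<⇒≤ t<d))))))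

    sums : total inner Y + (total onFreed Y + total (nestedWith matched ∘ shE) Y) ≡
           total (nested (1 , b)) Y + (total (nestedWith old) Y + total hits Y)
    sums = begin
      total inner Y + (total onFreed Y + total (nestedWith matched ∘ shE) Y)
        ≡⟨ trans (total-+ inner _ Y) (cong (total inner Y +_) (total-+ onFreed (nestedWith matched ∘ shE) Y)) ⟨
      total (λ y → inner y + (onFreed y + nestedWith matched (shE y))) Y
        ≡⟨ total-cong (All.zipWith (λ {y} → pointwise y) (Y-split , All.zip (1<Y , b≢Y))) ⟩
      total (λ y → nested (1 , b) y + (nestedWith old y + hits y)) Y
        ≡⟨ trans (total-+ (nested (1 , b)) _ Y) (cong (total (nested (1 , b)) Y +_) (total-+ (nestedWith old) hits Y)) ⟩
      total (nested (1 , b)) Y + (total (nestedWith old) Y + total hits Y) ∎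

-- The map φ expressed by cutting and reassembling

crossingFirst : ℕ → ℕ → RawMatching → RawMatching
crossingFirst a r = filterᵇ (crossedᵇ (a , r))

avoidingFirst : ℕ → ℕ → RawMatching → RawMatching
avoidingFirst a r = filterᵇ (λ f → not (crossedᵇ (a , r) f) ∧ not (isEdgeᵇ (a , r) f))

restoreFirst : ℕ → ℕ → RawMatching → RawMatching
restoreFirst a r N = sortE ((a , r) ∷ mapE (insRenum r) N)

-- The clause of `φ'` for two or more edges, with the recursive result replaced by a variable. What
-- is proved about it then holds for every matching with first edge (1 , b), not only for images
-- under φ.
combine : ℕ → ℕ → ℕ → ℕ → RawMatching → RawMatching
combine a r l₂ r₂ N =
  if r <ᵇ l₂ then restoreFirst a r N
  else (if r <ᵇ r₂ then case2 l₂ r (crossingFirst a r (restoreFirst a r N)) ((a , r) ∷ avoidingFirst a r (restoreFirst a r N))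
        else case3 l₂ r₂ r (crossingFirst a r (restoreFirst a r N))
               ((a , r) ∷ filterᵇ (λ f → not (isEdgeᵇ (l₂ , r₂) f)) (avoidingFirst a r (restoreFirst a r N))))

extend : ℕ → RawMatching → RawMatching
extend t M = (1 , suc t) ∷ mapE (insRenum (suc t)) M

-- `delRenum` undoes `insRenum`, so the recursive call receives the matching as it was before the
-- extension; everything else agrees by definition.
φ′-extend : ∀ k t b R → φ' (suc k) (extend t ((1 , b) ∷ R)) ≡
  combine 1 (suc t) (insRenum (suc t) 1) (insRenum (suc t) b) (φ' k ((1 , b) ∷ R))
φ′-extend k t b R = cong (λ M → combine 1 (suc t) (insRenum (suc t) 1) (insRenum (suc t) b) (φ' k M))
  (trans (mapE-∘ (delRenum (suc t)) (insRenum (suc t)) ((1 , b) ∷ R))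
    (mapE-id-local (All.universal (delRenum-insRenum t) (vertices ((1 , b) ∷ R)))))

1<insRenum : ∀ t {v} → 1 ≤ v → 1 < insRenum (suc t) v
1<insRenum t {v} 1≤v with v <? t
... | yes v<t rewrite insRenum-below v<t = s≤s 1≤v
... | no v≮t rewrite insRenum-above (≮⇒≥ v≮t) = s≤s (s≤s z≤n)

insRenum-<ᵇ : ∀ t v → (insRenum (suc t) v <ᵇ suc t) ≡ (v <ᵇ t)
insRenum-<ᵇ t v with v <? t
... | yes v<t rewrite insRenum-below v<t = refl
... | no v≮t rewrite insRenum-above (≮⇒≥ v≮t) =
  trans (<ᵇ-false (m≤n⇒m≤1+n (≮⇒≥ v≮t))) (sym (<ᵇ-false (≮⇒≥ v≮t)))

<ᵇ-insRenum : ∀ t v → (suc t <ᵇ insRenum (suc t) v) ≡ (t ≤ᵇ v)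
<ᵇ-insRenum t v with v <? t
... | yes v<t rewrite insRenum-below v<t = trans (<ᵇ-false (<⇒≤ v<t)) (sym (≤ᵇ-false v<t))
... | no v≮t rewrite insRenum-above (≮⇒≥ v≮t) = trans (<ᵇ-true (s≤s (≮⇒≥ v≮t))) (sym (≤ᵇ-true (≮⇒≥ v≮t)))

-- The image of `c` lies inside the first edge exactly when `c < t`, that of `d` beyond it exactly
-- when `t ≤ d`. Since no vertex precedes 1, the other alternative of `crossedᵇ` fails.
crossed-insRenum : ∀ t {c} d → 1 ≤ c →
  crossedᵇ (1 , suc t) (insRenum (suc t) c , insRenum (suc t) d) ≡ crossesAt t (c , d)
crossed-insRenum t {c} d 1≤c
  rewrite <ᵇ-true (1<insRenum t 1≤c) | <ᵇ-false (<⇒≤ (1<insRenum t 1≤c))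
        | insRenum-<ᵇ t c | <ᵇ-insRenum t d = ∨-identityʳ _

restoreFirst-sorted : ∀ m t {N} → IsMatching m N → restoreFirst 1 (suc t) N ≡ (1 , suc t) ∷ mapE (insRenum (suc t)) N
restoreFirst-sorted m t {N} mN@(_ , _ , p) = sortE-id
  (All.map⁺ (All.map (λ ((1≤c , _) , _) → 1<insRenum t 1≤c) (All-ends (matching-bounds m N p)))
   ∷ AllPairs.map⁺ (AllPairs.map (embedding-mono {insRenum (suc t)} (insRenum-embedding t)) (sorted-lefts m mN)))

crossingFirst-restoreFirst : ∀ m t {N} → IsMatching m N →
  crossingFirst 1 (suc t) (restoreFirst 1 (suc t) N) ≡ mapE (insRenum (suc t)) (crossingEdges t N)
crossingFirst-restoreFirst m t {N} mN@(_ , _ , p) = trans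
  (cong (crossingFirst 1 (suc t)) (restoreFirst-sorted m t mN))
  (filterᵇ-map {p = crossedᵇ (1 , suc t)} {crossesAt t} _ {N} (All.map (λ {e} ((1≤c , _) , _) → crossed-insRenum t (proj₂ e) 1≤c) (All-ends (matching-bounds m N p))))

avoidingFirst-restoreFirst : ∀ m t {N} → IsMatching m N →
  avoidingFirst 1 (suc t) (restoreFirst 1 (suc t) N) ≡ mapE (insRenum (suc t)) (otherEdges t N)
avoidingFirst-restoreFirst m t {N} mN@(_ , _ , p) = trans
  (cong (avoidingFirst 1 (suc t)) (restoreFirst-sorted m t mN))
  (trans (filterᵇ-reject avoid {1 , suc t} (cong not (≡ᵇ-refl t)))
    (filterᵇ-map {p = avoid} {not ∘ crossesAt t} _ {N} (All.map (λ {e} ((1≤c , _) , _) → avoids e 1≤c) (All-ends (matching-bounds m N p)))))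
  where
  avoid : Edge → Bool
  avoid f = not (crossedᵇ (1 , suc t) f) ∧ not (isEdgeᵇ (1 , suc t) f)

  avoids : ∀ e → 1 ≤ proj₁ e →
    not (crossedᵇ (1 , suc t) (insRenum (suc t) (proj₁ e) , insRenum (suc t) (proj₂ e)))
      ∧ not (isEdgeᵇ (1 , suc t) (insRenum (suc t) (proj₁ e) , insRenum (suc t) (proj₂ e)))
    ≡ not (crossesAt t e)
  avoids (c , d) 1≤c rewrite crossed-insRenum t d 1≤c | ≡ᵇ-false (<⇒≢ (1<insRenum t 1≤c)) = ∧-identityʳ _

norm-ordered : ∀ {a b} → a ≤ b → norm (a , b) ≡ (a , b)
norm-ordered a≤b = cong₂ _,_ (m≤n⇒m⊓n≡m a≤b) (m≤n⇒m⊔n≡n a≤b)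

norm-reversed : ∀ {a b} → b ≤ a → norm (a , b) ≡ (b , a)
norm-reversed b≤a = cong₂ _,_ (m≥n⇒m⊓n≡n b≤a) (m≥n⇒m⊔n≡m b≤a)

finalRenum-fixed : ∀ {t} → 1 < t → finalRenum 2 (suc t) (suc t) ≡ suc t
finalRenum-fixed {t} 1<t rewrite <ᵇ-false {suc t} {2} (s≤s (<⇒≤ 1<t)) | <ᵇ-false (≤-refl {t}) = refl

module _ {t} (1<t : 1 < t) where

  private
    ins sh g : ℕ → ℕ
    ins = insRenum (suc t)
    sh = shiftAt t
    g = finalRenum 2 (suc t)

    g-low : ∀ {v} → 1 < v → v < t → g (ins v) ≡ v
    g-low 1<v v<t = trans (finalRenum-insRenum 1<t (<⇒≤ 1<v)) (shiftAt-below v<t)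

    g-high : ∀ {v} → t ≤ v → g (ins v) ≡ sh v
    g-high t≤v = finalRenum-insRenum 1<t (≤-trans (<⇒≤ 1<t) t≤v)

    t<sh : ∀ {v} → t ≤ v → t < sh v
    t<sh t≤v rewrite shiftAt-above t≤v = m≤n⇒m≤1+n (s≤s t≤v)

  norm-reconnect : ∀ {l r} → 1 < l → l < t → t ≤ r → norm (g (ins r) , g (ins l)) ≡ (l , sh r)
  norm-reconnect 1<l l<t t≤r rewrite g-low 1<l l<t | g-high t≤r = norm-reversed (<⇒≤ (<-trans l<t (t<sh t≤r)))

  reconnect : ∀ {ls rs} → All (1 <_) ls → All (_< t) ls → All (t ≤_) rs →
    zipWith (λ r l → norm (g r , g l)) (map ins rs) (map ins ls) ≡ zip ls (map sh rs)
  reconnect {rs = []}    []           []           []           = refl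
  reconnect {rs = _ ∷ _} []           []           (_ ∷ _)      = refl
  reconnect              (_ ∷ _)      (_ ∷ _)      []           = refl
  reconnect              (1<l ∷ 1<ls) (l<t ∷ ls<t) (t≤r ∷ t≤rs) =
    cong₂ _∷_ (norm-reconnect 1<l l<t t≤r) (reconnect 1<ls ls<t t≤rs)

  -- `case2` puts the edge at `t` in front of the chain, whereas in the zip it comes last; every
  -- step of the induction moves it past one link. The default 0 of `lastOr` is overwritten by the
  -- first right end.
  reconnect-chain : ∀ {b ls rs} → length ls ≡ length rs → All (1 <_) ls → All (_< t) ls → t ≤ b → All (t ≤_) rs →
    norm (t , g (lastOr 0 (map ins (b ∷ rs)))) ∷ zipWith (λ r l → norm (g r , g l)) (map ins (b ∷ rs)) (map ins ls)
      ↭ zip (ls ∷ʳ t) (map sh (b ∷ rs))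
  reconnect-chain {rs = []} _ [] [] t≤b [] rewrite g-high t≤b = ↭-reflexive (cong [_] (norm-ordered (<⇒≤ (t<sh t≤b))))
  reconnect-chain {ls = l ∷ _} {rs = r ∷ rs} len (1<l ∷ 1<ls) (l<t ∷ ls<t) t≤b (t≤r ∷ t≤rs)
    rewrite norm-reconnect 1<l l<t t≤b =
    ↭-trans (↭-swap _ (l , _) ↭-refl) (↭-prep _ (reconnect-chain (suc-injective len) 1<ls ls<t t≤r t≤rs))

  renumber-others : ∀ {Y} → All (λ e → 1 < proj₁ e × 1 < proj₂ e) Y →
    mapE g ((1 , suc t) ∷ mapE ins Y) ≡ (1 , suc t) ∷ mapE sh Y
  renumber-others {Y} 1<Y = cong₂ _∷_ (cong (1 ,_) (finalRenum-fixed 1<t))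
    (trans (mapE-∘ g ins Y) (mapE-cong-local (All.map (finalRenum-insRenum 1<t ∘ <⇒≤) (All-vertices 1<Y))))

-- The second left end is the least vertex other than 1 and r, so alignment forces r = 2, that is t
-- = 1. Every old vertex then moves up by 2 under either renumbering.
combine-aligned : ∀ m r₂ {N} → IsMatching m N → combine 1 2 3 r₂ N ≡ (1 , 2) ∷ mapE (shiftAt 1) N
combine-aligned m r₂ {N} mN@(_ , _ , p) = trans (restoreFirst-sorted m 1 mN) (cong ((1 , 2) ∷_)
  (mapE-cong-local (All.map (λ (1≤v , _) → trans (insRenum-above 1≤v) (sym (shiftAt-above 1≤v))) (matching-bounds m N p))))

module _ m {t b R} (1<t : 1 < t) (t≤1+2m : t ≤ suc (2 * m)) (mN : IsMatching m ((1 , b) ∷ R)) where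

  private
    ins sh g : ℕ → ℕ
    ins = insRenum (suc t)
    sh = shiftAt t
    g = finalRenum 2 (suc t)

    X Y : RawMatching
    X = crossingEdges t R
    Y = otherEdges t R

    ls rs : List ℕ
    ls = map proj₁ X
    rs = map proj₂ X

    c : Cut m t b ls rs Y
    c = cut m 1<t t≤1+2m mN
    open Cut c hiding (1<t; t≤1+2m)

    2≮ : (suc t <ᵇ 2) ≡ false
    2≮ = <ᵇ-false {suc t} {2} (s≤s (<⇒≤ 1<t))

    sort-assembled : ∀ L E ls′ rs′ → Rewired t b ls rs E ls′ rs′ → L ↭ assemble t E ls′ rs′ Y →
      sortE L ≡ sortE (assemble t E ls′ rs′ Y)
    sort-assembled L E ls′ rs′ r p =
      sym (sortE-cong (↭-sym p) (unique-lefts (suc m) (assemble t E ls′ rs′ Y) (assemble-vertices c r)))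

    index-eq : count (λ e → ins b <ᵇ proj₁ e) (mapE ins X) ≡ freedIndex b ls
    index-eq = trans (count-map _ (All.universal (λ e → insRenum-embedding t b (proj₁ e)) X))
                     (sym (count-map proj₁ (All.universal (λ _ → refl) X)))

    not-second : filterᵇ (λ f → not (isEdgeᵇ (2 , ins b) f)) (mapE ins Y) ≡ mapE ins Y
    not-second = filterᵇ-all _ (All.map⁺ (All.map (λ {e} (1<c , _) → avoids e 1<c) 1<Y))
      where
      avoids : ∀ e → 1 < proj₁ e → not (isEdgeᵇ (2 , ins b) (ins (proj₁ e) , ins (proj₂ e))) ≡ true
      avoids e 1<c rewrite ≡ᵇ-false (<⇒≢ (subst (_< ins (proj₁ e)) (insRenum-below 1<t) (embedding-mono {ins} (insRenum-embedding t) 1<c))) = refl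

  -- As `t ≤ b`, the second edge heads the list of crossing edges. Thus `drop 1` removes precisely
  -- its left end, and the right ends `b ∷ rs` meet `ls` shifted by one place.
  combine-crossed : t ≤ b →
    combine 1 (suc t) 2 (ins b) ((1 , b) ∷ R) ≡ sortE (assemble t [] (ls ∷ʳ t) (b ∷ rs) Y)
  combine-crossed t≤b =
    trans (combine-selects (trans (<ᵇ-insRenum t b) (≤ᵇ-true t≤b)))
    (trans (cong₂ (λ C Z → case2 2 (suc t) C ((1 , suc t) ∷ Z)) crossings others)
    (trans (cong₂ (λ Ls Rs → sortE (norm (t , g (lastOr 0 Rs)) ∷ zipWith (λ r l → norm (g r , g l)) Rs (drop 1 Ls)
                                    ++ mapE g ((1 , suc t) ∷ mapE ins Y)))
             (lefts-mapE ins ((1 , b) ∷ X)) (rights-mapE ins ((1 , b) ∷ X)))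
    (sort-assembled renumbered [] (ls ∷ʳ t) (b ∷ rs) (rewired-crossed c t≤b) (begin
      renumbered
        ↭⟨ ++⁺ (reconnect-chain 1<t same-length 1<ls ls<t t≤b t≤rs) (↭-reflexive (renumber-others 1<t 1<Y)) ⟩
      zip (ls ∷ʳ t) (map sh (b ∷ rs)) ++ (1 , suc t) ∷ mapE sh Y
        ↭⟨ shift (1 , suc t) (zip (ls ∷ʳ t) (map sh (b ∷ rs))) _ ⟩
      assemble t [] (ls ∷ʳ t) (b ∷ rs) Y ∎))))
    where
    open PermutationReasoning
    N₂ : RawMatching
    N₂ = restoreFirst 1 (suc t) ((1 , b) ∷ R)

    combine-selects : (suc t <ᵇ ins b) ≡ true → combine 1 (suc t) 2 (ins b) ((1 , b) ∷ R) ≡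
      case2 2 (suc t) (crossingFirst 1 (suc t) N₂) ((1 , suc t) ∷ avoidingFirst 1 (suc t) N₂)
    combine-selects eq rewrite 2≮ | eq = refl

    1b-crosses : crossesAt t (1 , b) ≡ true
    1b-crosses rewrite <ᵇ-true 1<t = ≤ᵇ-true t≤b

    crossings : crossingFirst 1 (suc t) N₂ ≡ mapE ins ((1 , b) ∷ X)
    crossings = trans (crossingFirst-restoreFirst m t mN) (cong (mapE ins) (filterᵇ-accept (crossesAt t) 1b-crosses))

    others : avoidingFirst 1 (suc t) N₂ ≡ mapE ins Y
    others = trans (avoidingFirst-restoreFirst m t mN)
      (cong (mapE ins) (filterᵇ-reject (not ∘ crossesAt t) (cong not 1b-crosses)))

    renumbered : RawMatching
    renumbered = norm (t , g (lastOr 0 (map ins (b ∷ rs))))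
      ∷ zipWith (λ r l → norm (g r , g l)) (map ins (b ∷ rs)) (map ins ls) ++ mapE g ((1 , suc t) ∷ mapE ins Y)

  -- `insRenum (suc t)` preserves order, so inserting `b` among the left ends, counting those beyond
  -- it and selecting by index all commute with it. This lets Case 3 be read in the coordinates of
  -- N.
  combine-nested : b < t →
    combine 1 (suc t) 2 (ins b) ((1 , b) ∷ R) ≡ sortE (assemble t [ (freed b ls , t) ] (kept b ls) rs Y)
  combine-nested b<t =
    trans (combine-selects (trans (<ᵇ-insRenum t b) (≤ᵇ-false b<t)))
    (trans (cong₂ (λ C Z → case3 2 (ins b) (suc t) C ((1 , suc t) ∷ Z)) crossings others)
    (trans (cong₃ (λ Ls Rs s → sortE (norm (t , g (nthOr 0 (insertℕ (ins b) Ls) s))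
                     ∷ zipWith (λ r l → norm (g r , g l)) Rs (removeNth (insertℕ (ins b) Ls) s) ++ mapE g ((1 , suc t) ∷ mapE ins Y)))
             (lefts-mapE ins X) (rights-mapE ins X) index-eq)
    (trans (cong (λ V → sortE (norm (t , g (nthOr 0 V (freedIndex b ls)))
                     ∷ zipWith (λ r l → norm (g r , g l)) (map ins rs) (removeNth V (freedIndex b ls)) ++ mapE g ((1 , suc t) ∷ mapE ins Y)))
             (insertℕ-map {ins} (insRenum-embedding t) b ls))
    (trans (cong₂ (λ w V → sortE (norm (t , g w) ∷ zipWith (λ r l → norm (g r , g l)) (map ins rs) V ++ mapE g ((1 , suc t) ∷ mapE ins Y)))
             (nthOr-map ins 0 0 (slots b ls) (freedIndex-< b ls)) (removeNth-map ins (slots b ls) (freedIndex b ls)))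
    (sort-assembled renumbered [ (freed b ls , t) ] (kept b ls) rs r (begin
      renumbered
        ≡⟨ cong₂ _∷_ freed-edge (cong₂ _++_ (reconnect 1<t (Rewired.1<ls′ r) kept<t t≤rs) (renumber-others 1<t 1<Y)) ⟩
      (v , t) ∷ zip (kept b ls) (map sh rs) ++ (1 , suc t) ∷ mapE sh Y
        ↭⟨ shift (1 , suc t) ((v , t) ∷ zip (kept b ls) (map sh rs)) _ ⟩
      assemble t [ (v , t) ] (kept b ls) rs Y ∎))))))
    where
    open PermutationReasoning
    cong₃ : ∀ {A B C D : Set} (f : A → B → C → D) {x x′ y y′ z z′} → x ≡ x′ → y ≡ y′ → z ≡ z′ → f x y z ≡ f x′ y′ z′
    cong₃ f refl refl refl = refl

    N₂ : RawMatching
    N₂ = restoreFirst 1 (suc t) ((1 , b) ∷ R)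

    notSecond : Edge → Bool
    notSecond f = not (isEdgeᵇ (2 , ins b) f)

    combine-selects : (suc t <ᵇ ins b) ≡ false → combine 1 (suc t) 2 (ins b) ((1 , b) ∷ R) ≡
      case3 2 (ins b) (suc t) (crossingFirst 1 (suc t) N₂) ((1 , suc t) ∷ filterᵇ notSecond (avoidingFirst 1 (suc t) N₂))
    combine-selects eq rewrite 2≮ | eq = refl

    1b-avoids : crossesAt t (1 , b) ≡ false
    1b-avoids rewrite ≤ᵇ-false b<t = ∧-zeroʳ (1 <ᵇ t)

    crossings : crossingFirst 1 (suc t) N₂ ≡ mapE ins X
    crossings = trans (crossingFirst-restoreFirst m t mN) (cong (mapE ins) (filterᵇ-reject (crossesAt t) 1b-avoids))

    second : notSecond (ins 1 , ins b) ≡ false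
    second rewrite insRenum-below 1<t | ≡ᵇ-refl (ins b) = refl

    others : filterᵇ notSecond (avoidingFirst 1 (suc t) N₂) ≡ mapE ins Y
    others = trans
      (cong (filterᵇ notSecond) (trans (avoidingFirst-restoreFirst m t mN)
        (cong (mapE ins) (filterᵇ-accept (not ∘ crossesAt t) (cong not 1b-avoids)))))
      (trans (filterᵇ-reject notSecond {ins 1 , ins b} {mapE ins Y} second) not-second)

    r : Rewired t b ls rs [ (freed b ls , t) ] (kept b ls) rs
    r = rewired-nested c b<t

    v : ℕ
    v = freed b ls

    renumbered : RawMatching
    renumbered = norm (t , g (ins v))
      ∷ zipWith (λ r l → norm (g r , g l)) (map ins rs) (map ins (kept b ls)) ++ mapE g ((1 , suc t) ∷ mapE ins Y)

    kept<t : All (_< t) (kept b ls)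
    kept<t = All.tail (All-resp-↭ (freed-kept-↭ b ls) (b<t ∷ ls<t))

    freed-edge : norm (t , g (ins v)) ≡ (v , t)
    freed-edge with Rewired.E-inside r
    ... | (1<v , v<t , _) ∷ [] =
      trans (cong (λ x → norm (t , x)) (trans (finalRenum-insRenum 1<t (<⇒≤ 1<v)) (shiftAt-below v<t))) (norm-reversed (<⇒≤ v<t))

-- Recovering the parts of a matching from its reassembly

++-cancelˡ-↭ : ∀ {A : Set} (xs : List A) {ys zs} → xs ++ ys ↭ xs ++ zs → ys ↭ zs
++-cancelˡ-↭ []       p = p
++-cancelˡ-↭ (x ∷ xs) p = ++-cancelˡ-↭ xs (drop-∷ p)

count-mono : ∀ {A : Set} {p q : A → Bool} → (∀ x → p x ≡ true → q x ≡ true) → ∀ xs → count p xs ≤ count q xs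
count-mono p⇒q [] = z≤n
count-mono {p = p} {q} p⇒q (x ∷ xs) with p x in eq
... | true rewrite p⇒q x eq = s≤s (count-mono p⇒q xs)
... | false with q x
...   | true  = m≤n⇒m≤1+n (count-mono p⇒q xs)
...   | false = count-mono p⇒q xs

-- Whatever exceeds y exceeds x, and strictness comes from y itself: it belongs to V and exceeds x,
-- but not y.
count-above-anti : ∀ {x y V W} → V ↭ y ∷ W → x < y → count (y <ᵇ_) V < count (x <ᵇ_) V
count-above-anti {x} {y} {V} {W} p x<y = begin-strict
  count (y <ᵇ_) V         ≡⟨ count-↭ (y <ᵇ_) p ⟩
  count (y <ᵇ_) (y ∷ W)   ≡⟨ cong length (filterᵇ-reject (y <ᵇ_) {y} {W} (<ᵇ-false (≤-refl {y}))) ⟩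
  count (y <ᵇ_) W         ≤⟨ count-mono (λ v y<v → <ᵇ-true {x} {v} (<-trans x<y (<ᵇ≡true⇒< {y} {v} y<v))) W ⟩
  count (x <ᵇ_) W         <⟨ ≤-refl ⟩
  suc (count (x <ᵇ_) W)   ≡⟨ cong length (filterᵇ-accept (x <ᵇ_) {y} {W} (<ᵇ-true x<y)) ⟨
  count (x <ᵇ_) (y ∷ W)   ≡⟨ count-↭ (x <ᵇ_) p ⟨
  count (x <ᵇ_) V         ∎
  where open ≤-Reasoning

freedIndex-slots : ∀ b ls → freedIndex b ls ≡ count (b <ᵇ_) (slots b ls)
freedIndex-slots b ls = sym (trans (count-↭ (b <ᵇ_) (insertℕ-↭ b ls))
  (cong length (filterᵇ-reject (b <ᵇ_) {b} {ls} (<ᵇ-false (≤-refl {b})))))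

-- The freed slot has as many slots to its left as b has to its right, so b can be
-- located from the freed slot.
slots-injective : ∀ {b b′ ls ls′} → slots b ls ≡ slots b′ ls′ → freedIndex b ls ≡ freedIndex b′ ls′ → b ≡ b′
slots-injective {b} {b′} {ls} {ls′} eqV eqs with <-cmp b b′
... | tri≈ _ eq _ = eq
... | tri< b<b′ _ _ = contradiction same (<⇒≢ (count-above-anti (insertℕ-↭ b′ ls′) b<b′))
  where
  same : count (b′ <ᵇ_) (slots b′ ls′) ≡ count (b <ᵇ_) (slots b′ ls′)
  same = trans (sym (freedIndex-slots b′ ls′)) (trans (sym eqs) (trans (freedIndex-slots b ls) (cong (count (b <ᵇ_)) eqV)))
... | tri> _ _ b′<b = contradiction same (<⇒≢ (count-above-anti (insertℕ-↭ b ls) b′<b))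
  where
  same : count (b <ᵇ_) (slots b ls) ≡ count (b′ <ᵇ_) (slots b ls)
  same = trans (sym (freedIndex-slots b ls)) (trans eqs (trans (freedIndex-slots b′ ls′) (cong (count (b′ <ᵇ_)) (sym eqV))))

map-shiftAt-injective : ∀ t {xs ys} → map (shiftAt t) xs ≡ map (shiftAt t) ys → xs ≡ ys
map-shiftAt-injective t {xs} {ys} eq = trans (sym (undo xs)) (trans (cong (map (unshiftAt t)) eq) (undo ys))
  where
  undo : ∀ zs → map (unshiftAt t) (map (shiftAt t) zs) ≡ zs
  undo zs = trans (sym (map-∘ zs)) (map-id-local (All.universal (unshiftAt-shiftAt t) zs))

mapE-unshiftAt : ∀ t L → mapE (unshiftAt t) (mapE (shiftAt t) L) ≡ L
mapE-unshiftAt t L = trans (mapE-∘ (unshiftAt t) (shiftAt t) L)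
  (mapE-id-local (All.universal (unshiftAt-shiftAt t) (vertices L)))

-- Equality with `t` is allowed on the left because Case 2 makes `t` the last left end across the
-- gap.
spansᵇ : ℕ → Edge → Bool
spansᵇ t e = (proj₁ e ≤ᵇ t) ∧ (suc t <ᵇ proj₂ e)

-- Tells the cases apart in the image: `t` is a right end in Case 3 but a left end in Case 2.
closesᵇ : ℕ → Edge → Bool
closesᵇ t e = proj₂ e ≡ᵇ t

module _ {m t b ls rs Y E ls′ rs′} (c : Cut m t b ls rs Y) (r : Rewired t b ls rs E ls′ rs′) where
  open Cut c
  open Rewired r

  private
    sh : ℕ → ℕ
    sh = shiftAt t

    matched : List Edge
    matched = zip ls′ (map sh rs′)

    same-length″ : length ls′ ≡ length (map sh rs′)
    same-length″ = trans same-length′ (sym (length-map sh rs′))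

    filterᵇ-++ : ∀ (p : Edge → Bool) xs ys → filterᵇ p (xs ++ ys) ≡ filterᵇ p xs ++ filterᵇ p ys
    filterᵇ-++ p = filter-++ (T? ∘ p)

    spans-false : ∀ {a d} → d ≤ suc t → spansᵇ t (a , d) ≡ false
    spans-false {a} d≤ = trans (cong ((a ≤ᵇ t) ∧_) (<ᵇ-false d≤)) (∧-zeroʳ (a ≤ᵇ t))

  spanning-edges : filterᵇ (spansᵇ t) (assemble t E ls′ rs′ Y) ≡ matched
  spanning-edges = begin
    filterᵇ (spansᵇ t) (assemble t E ls′ rs′ Y)
      ≡⟨ filterᵇ-reject (spansᵇ t) {1 , suc t} (spans-false {1} ≤-refl) ⟩
    filterᵇ (spansᵇ t) (E ++ matched ++ mapE sh Y)
      ≡⟨ trans (filterᵇ-++ (spansᵇ t) E _) (cong (filterᵇ (spansᵇ t) E ++_) (filterᵇ-++ (spansᵇ t) matched _)) ⟩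
    filterᵇ (spansᵇ t) E ++ filterᵇ (spansᵇ t) matched ++ filterᵇ (spansᵇ t) (mapE sh Y)
      ≡⟨ cong₂ _++_
           (filterᵇ-none (spansᵇ t) (All.map (λ {e} (_ , _ , eq) → spans-false {proj₁ e} (≤-trans (≤-reflexive eq) (n≤1+n t))) E-inside))
           (cong₂ _++_
             (filterᵇ-all (spansᵇ t) (All.map (λ (l≤t , t<r) → cong₂ _∧_ (≤ᵇ-true l≤t) (<ᵇ-true t<r)) (All-zip ls′≤t (shifted-rights c r))))
             (filterᵇ-none (spansᵇ t) (All.map⁺ (All.map (λ {e} → other e) Y-split)))) ⟩
    matched ++ []
      ≡⟨ ++-identityʳ matched ⟩
    matched ∎
    where
    open ≡-Reasoning
    other : ∀ e → Ordered e × (proj₂ e < t ⊎ t ≤ proj₁ e) → spansᵇ t (sh (proj₁ e) , sh (proj₂ e)) ≡ false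
    other (c′ , d) (_ , inj₁ d<t) rewrite shiftAt-below d<t = spans-false {sh c′} (m≤n⇒m≤1+n (<⇒≤ d<t))
    other (c′ , d) (_ , inj₂ t≤c) rewrite shiftAt-above t≤c | ≤ᵇ-false {2 + c′} {t} (s≤s (m≤n⇒m≤1+n t≤c)) = refl

  closing-edges : filterᵇ (closesᵇ t) (assemble t E ls′ rs′ Y) ≡ E
  closing-edges = begin
    filterᵇ (closesᵇ t) (assemble t E ls′ rs′ Y)
      ≡⟨ filterᵇ-reject (closesᵇ t) {1 , suc t} (≡ᵇ-false (1+n≢n {t})) ⟩
    filterᵇ (closesᵇ t) (E ++ matched ++ mapE sh Y)
      ≡⟨ trans (filterᵇ-++ (closesᵇ t) E _) (cong (filterᵇ (closesᵇ t) E ++_) (filterᵇ-++ (closesᵇ t) matched _)) ⟩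
    filterᵇ (closesᵇ t) E ++ filterᵇ (closesᵇ t) matched ++ filterᵇ (closesᵇ t) (mapE sh Y)
      ≡⟨ cong₂ _++_
           (filterᵇ-all (closesᵇ t) (All.map (λ (_ , _ , eq) → trans (cong (_≡ᵇ t) eq) (≡ᵇ-refl t)) E-inside))
           (cong₂ _++_
             (filterᵇ-none (closesᵇ t) (All.map (λ t<r → ≡ᵇ-false (>⇒≢ (<-trans ≤-refl t<r))) (All-zip-right ls′ (shifted-rights c r))))
             (filterᵇ-none (closesᵇ t) (All.map⁺ (All.universal (λ e → ≡ᵇ-false (shiftAt-≢ (proj₂ e))) Y)))) ⟩
    E ++ []
      ≡⟨ ++-identityʳ E ⟩
    E ∎
    where
    open ≡-Reasoning
    shiftAt-≢ : ∀ v → sh v ≢ t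
    shiftAt-≢ v with v <? t
    ... | yes v<t rewrite shiftAt-below v<t = <⇒≢ v<t
    ... | no v≮t rewrite shiftAt-above (≮⇒≥ v≮t) = >⇒≢ (s≤s (m≤n⇒m≤1+n (≮⇒≥ v≮t)))

  matched-sorted : AllPairs _<ₗ_ matched
  matched-sorted = AllPairs.map⁻ (subst (AllPairs _<_) (sym (lefts-zip ls′ (map sh rs′) same-length″)) ls′-sorted)

  matched-lefts : map proj₁ matched ≡ ls′
  matched-lefts = lefts-zip ls′ (map sh rs′) same-length″

  matched-rights : map proj₂ matched ≡ map sh rs′
  matched-rights = rights-zip ls′ (map sh rs′) same-length″

record SameParts (E₁ E₂ : List Edge) (ls₁ ls₂ rs₁ rs₂ : List ℕ) (Y₁ Y₂ : RawMatching) : Set where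
  field
    E-↭ : E₁ ↭ E₂
    ls-≡ : ls₁ ≡ ls₂
    rs-≡ : rs₁ ≡ rs₂
    Y-↭ : Y₁ ↭ Y₂

-- The closing edge and the edges across the gap are cut out of the image by filters that depend on
-- `t` alone, and the rest follows by cancellation. The edges across the gap agree even as lists,
-- being strictly sorted on both sides, so their sequences of left and right ends agree too.
assemble-injective : ∀ {m t b₁ b₂ ls₁ ls₂ rs₁ rs₂ Y₁ Y₂ E₁ E₂ ls₁′ ls₂′ rs₁′ rs₂′} →
  Cut m t b₁ ls₁ rs₁ Y₁ → Rewired t b₁ ls₁ rs₁ E₁ ls₁′ rs₁′ →
  Cut m t b₂ ls₂ rs₂ Y₂ → Rewired t b₂ ls₂ rs₂ E₂ ls₂′ rs₂′ →
  sortE (assemble t E₁ ls₁′ rs₁′ Y₁) ≡ sortE (assemble t E₂ ls₂′ rs₂′ Y₂) →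
  SameParts E₁ E₂ ls₁′ ls₂′ rs₁′ rs₂′ Y₁ Y₂
assemble-injective {t = t} {Y₁ = Y₁} {Y₂} {E₁} {E₂} {ls₁′} {ls₂′} {rs₁′} {rs₂′} c₁ r₁ c₂ r₂ eq = record
  { E-↭ = E-perm
  ; ls-≡ = trans (sym (matched-lefts c₁ r₁)) (trans (cong (map proj₁) matched-≡) (matched-lefts c₂ r₂))
  ; rs-≡ = map-shiftAt-injective t
      (trans (sym (matched-rights c₁ r₁)) (trans (cong (map proj₂) matched-≡) (matched-rights c₂ r₂)))
  ; Y-↭ = subst₂ _↭_ (mapE-unshiftAt t Y₁) (mapE-unshiftAt t Y₂) (map⁺ _ shifted-Y)
  }
  where
  matched₁ matched₂ : List Edge
  matched₁ = zip ls₁′ (map (shiftAt t) rs₁′)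
  matched₂ = zip ls₂′ (map (shiftAt t) rs₂′)

  assembled : assemble t E₁ ls₁′ rs₁′ Y₁ ↭ assemble t E₂ ls₂′ rs₂′ Y₂
  assembled = ↭-trans (↭-sym (sortE-↭ _)) (↭-trans (↭-reflexive eq) (sortE-↭ _))

  E-perm : E₁ ↭ E₂
  E-perm = subst₂ _↭_ (closing-edges c₁ r₁) (closing-edges c₂ r₂) (filter-↭ (T? ∘ closesᵇ t) assembled)

  matched-≡ : matched₁ ≡ matched₂
  matched-≡ = strictly-sorted-unique <-asym
    (subst₂ _↭_ (spanning-edges c₁ r₁) (spanning-edges c₂ r₂) (filter-↭ (T? ∘ spansᵇ t) assembled))
    (matched-sorted c₁ r₁) (matched-sorted c₂ r₂)

  shifted-Y : mapE (shiftAt t) Y₁ ↭ mapE (shiftAt t) Y₂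
  shifted-Y = ++-cancelˡ-↭ matched₁ (++-cancelˡ-↭ E₁ (drop-∷ (↭-trans assembled
    (↭-prep (1 , suc t) (++⁺ (↭-sym E-perm) (++⁺ʳ (mapE (shiftAt t) Y₂) (↭-reflexive (sym matched-≡))))))))

-- One step of the recursion: its image, its nestings, its injectivity

step : ℕ → ℕ → RawMatching → RawMatching
step t b R = combine 1 (suc t) (insRenum (suc t) 1) (insRenum (suc t) b) ((1 , b) ∷ R)

crossingLefts crossingRights : ℕ → RawMatching → List ℕ
crossingLefts t R = map proj₁ (crossingEdges t R)
crossingRights t R = map proj₂ (crossingEdges t R)

crossedResult nestedResult : ℕ → ℕ → RawMatching → RawMatching
crossedResult t b R = assemble t [] (crossingLefts t R ∷ʳ t) (b ∷ crossingRights t R) (otherEdges t R)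
nestedResult t b R = assemble t [ (freed b (crossingLefts t R) , t) ] (kept b (crossingLefts t R)) (crossingRights t R) (otherEdges t R)

module _ (m : ℕ) where

  data StepCase (t b : ℕ) (R : RawMatching) : Set where
    aligned : t ≡ 1 → step t b R ≡ (1 , 2) ∷ mapE (shiftAt 1) ((1 , b) ∷ R) → StepCase t b R
    crossed : 1 < t → t ≤ b →
      step t b R ≡ sortE (crossedResult t b R) → StepCase t b R
    nestedIn : 1 < t → b < t →
      step t b R ≡ sortE (nestedResult t b R) →
      StepCase t b R

  stepCase : ∀ {t b R} → 1 ≤ t → t ≤ suc (2 * m) → IsMatching m ((1 , b) ∷ R) → StepCase t b R
  stepCase {t} {b} {R} 1≤t t≤ mN with m≤n⇒m<n∨m≡n 1≤t
  ... | inj₂ refl = aligned refl (combine-aligned m (insRenum 2 b) mN)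
  ... | inj₁ 1<t with b <? t
  ...   | yes b<t = nestedIn 1<t b<t
    (trans (cong (λ l → combine 1 (suc t) l (insRenum (suc t) b) ((1 , b) ∷ R)) (insRenum-below 1<t)) (combine-nested m 1<t t≤ mN b<t))
  ...   | no b≮t = crossed 1<t (≮⇒≥ b≮t)
    (trans (cong (λ l → combine 1 (suc t) l (insRenum (suc t) b) ((1 , b) ∷ R)) (insRenum-below 1<t)) (combine-crossed m 1<t t≤ mN (≮⇒≥ b≮t)))

  module _ {t b R} (1≤t : 1 ≤ t) (t≤1+2m : t ≤ suc (2 * m)) (mN : IsMatching m ((1 , b) ∷ R)) where

    private
      aligned-vertices : vertices ((1 , 2) ∷ mapE (shiftAt 1) ((1 , b) ∷ R)) ↭ range2n (suc m)
      aligned-vertices = begin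
        1 ∷ 2 ∷ vertices (mapE (shiftAt 1) ((1 , b) ∷ R))  ≡⟨ cong (λ vs → 1 ∷ 2 ∷ vs) (vertices-mapE (shiftAt 1) ((1 , b) ∷ R)) ⟩
        1 ∷ 2 ∷ map (shiftAt 1) (vertices ((1 , b) ∷ R))   ↭⟨ ↭-prep 1 (↭-prep 2 (map⁺ (shiftAt 1) (proj₂ (proj₂ mN)))) ⟩
        1 ∷ 2 ∷ map (shiftAt 1) (range2n m)                ↭⟨ range-shiftAt (2 * m) ≤-refl (s≤s z≤n) ⟨
        range (2 + 2 * m)                                  ≡⟨ cong range (*-suc 2 m) ⟨
        range2n (suc m)                                    ∎
        where open PermutationReasoning

      aligned-lefts : All (λ e → 1 < proj₁ e × 1 < proj₂ e) (mapE (shiftAt 1) ((1 , b) ∷ R))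
      aligned-lefts = All.map⁺ (All.map (λ ((1≤c , _) , (1≤d , _)) → above 1≤c , above 1≤d)
        (All-ends (matching-bounds m ((1 , b) ∷ R) (proj₂ (proj₂ mN)))))
        where
        above : ∀ {v} → 1 ≤ v → 1 < shiftAt 1 v
        above 1≤v rewrite shiftAt-above 1≤v = s≤s (s≤s z≤n)

    step-matching : IsMatching (suc m) (step t b R)
    step-matching with stepCase 1≤t t≤1+2m mN
    ... | aligned refl eq = subst (IsMatching (suc m)) (sym eq)
      ( AllPairs⇒Linked (All.map proj₁ aligned-lefts
          ∷ AllPairs.map⁺ (AllPairs.map (embedding-mono {shiftAt 1} (shiftAt-embedding 1)) (sorted-lefts m mN)))
      , s≤s (s≤s z≤n) ∷ All.map⁺ (All.map (embedding-mono {shiftAt 1} (shiftAt-embedding 1)) (proj₁ (proj₂ mN)))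
      , aligned-vertices )
    ... | crossed 1<t t≤b eq = subst (IsMatching (suc m)) (sym eq)
      (sortE-matching (suc m) (crossedResult t b R) (assemble-ordered (cut m 1<t t≤1+2m mN) r) (assemble-vertices (cut m 1<t t≤1+2m mN) r))
      where r = rewired-crossed (cut m 1<t t≤1+2m mN) t≤b
    ... | nestedIn 1<t b<t eq = subst (IsMatching (suc m)) (sym eq)
      (sortE-matching (suc m) (nestedResult t b R) (assemble-ordered (cut m 1<t t≤1+2m mN) r) (assemble-vertices (cut m 1<t t≤1+2m mN) r))
      where r = rewired-nested (cut m 1<t t≤1+2m mN) b<t

    private
      head-assembled : ∀ {E ls′ rs′} → (c : Cut m t b (crossingLefts t R) (crossingRights t R) (otherEdges t R)) →
        Rewired t b (crossingLefts t R) (crossingRights t R) E ls′ rs′ →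
        ∃ λ R′ → sortE (assemble t E ls′ rs′ (otherEdges t R)) ≡ (1 , suc t) ∷ R′
      head-assembled {E} {ls′} {rs′} c r = _ , insertE-least (1 , suc t)
        (All-resp-↭ (↭-sym (sortE-↭ (E ++ zip ls′ (map (shiftAt t) rs′) ++ mapE (shiftAt t) (otherEdges t R)))) (All.map (proj₁ ∘ proj₁)
          (All.tail (All-ends {L = assemble t E ls′ rs′ (otherEdges t R)} (matching-bounds (suc m) (assemble t E ls′ rs′ (otherEdges t R)) (assemble-vertices c r))))))

    -- Makes `t` readable from the result, and keeps alive the invariant that φ preserves the first
    -- edge.
    step-head : ∃ λ R′ → step t b R ≡ (1 , suc t) ∷ R′
    step-head with stepCase 1≤t t≤1+2m mN
    ... | aligned refl eq = _ , eq
    ... | crossed 1<t t≤b eq with head-assembled (cut m 1<t t≤1+2m mN) (rewired-crossed (cut m 1<t t≤1+2m mN) t≤b)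
    ...   | R′ , eq′ = R′ , trans eq eq′
    step-head | nestedIn 1<t b<t eq with head-assembled (cut m 1<t t≤1+2m mN) (rewired-nested (cut m 1<t t≤1+2m mN) b<t)
    ...   | R′ , eq′ = R′ , trans eq eq′

    step-ne : ne (step t b R) ≡ (if b <ᵇ t then count (between b t) (range2n m) else 0) + ne ((1 , b) ∷ R)
    step-ne with stepCase 1≤t t≤1+2m mN
    ... | aligned refl eq = begin
      ne (step t b R)
        ≡⟨ trans (cong ne eq) (ne-∷ (1 , 2) shifted) ⟩
      total (nested (1 , 2)) shifted + ne shifted
        ≡⟨ cong₂ _+_
             (total-zero {xs = shifted} (All.map (λ {e} (1<c , 1<d) → trans (nested-by-rights {1 , 2} {e} 1<c) (cong ⟦_⟧ (<ᵇ-false 1<d))) aligned-lefts))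
             (ne-mapE {shiftAt 1} (shiftAt-embedding 1) ((1 , b) ∷ R)) ⟩
      ne ((1 , b) ∷ R)
        ≡⟨ cong (λ p → (if p then count (between b 1) (range2n m) else 0) + ne ((1 , b) ∷ R)) (<ᵇ-false (<⇒≤ (All.head (proj₁ (proj₂ mN))))) ⟨
      (if b <ᵇ 1 then count (between b 1) (range2n m) else 0) + ne ((1 , b) ∷ R) ∎
      where
      open ≡-Reasoning
      shifted : RawMatching
      shifted = mapE (shiftAt 1) ((1 , b) ∷ R)
    ... | crossed 1<t t≤b eq =
      trans (cong ne eq) (trans (ne-↭ (sortE-↭ (crossedResult t b R))) (trans (ne-crossed (cut m 1<t t≤1+2m mN) t≤b) (trans (ne-↭ (↭-sym (cut-↭ t b R)))
        (cong (λ p → (if p then count (between b t) (range2n m) else 0) + ne ((1 , b) ∷ R)) (sym (<ᵇ-false t≤b))))))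
    ... | nestedIn 1<t b<t eq =
      trans (cong ne eq) (trans (ne-↭ (sortE-↭ (nestedResult t b R))) (trans (ne-nested (cut m 1<t t≤1+2m mN) b<t)
        (trans (cong (count (between b t) (range2n m) +_) (sym (ne-↭ (cut-↭ t b R))))
          (cong (λ p → (if p then count (between b t) (range2n m) else 0) + ne ((1 , b) ∷ R)) (sym (<ᵇ-true b<t))))))

mapE-shiftAt-injective : ∀ t {L L′} → mapE (shiftAt t) L ≡ mapE (shiftAt t) L′ → L ≡ L′
mapE-shiftAt-injective t {L} {L′} eq =
  trans (sym (mapE-unshiftAt t L)) (trans (cong (mapE (unshiftAt t)) eq) (mapE-unshiftAt t L′))

-- Freed and kept slots together determine the sorted list of slots, and the number of kept slots
-- below the freed one determines s. From these `slots-injective` locates `b`, and `ls` is what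
-- remains.
freed-injective : ∀ {m₁ m₂ t b₁ b₂ ls₁ ls₂ rs₁ rs₂ Y₁ Y₂} → Cut m₁ t b₁ ls₁ rs₁ Y₁ → Cut m₂ t b₂ ls₂ rs₂ Y₂ →
  freed b₁ ls₁ ≡ freed b₂ ls₂ → kept b₁ ls₁ ≡ kept b₂ ls₂ → b₁ ≡ b₂ × ls₁ ≡ ls₂
freed-injective {b₁ = b₁} {b₂} {ls₁} {ls₂} c₁ c₂ freed≡ kept≡ = b≡ , strictly-sorted-unique <-asym
  (drop-∷ (subst (λ b → b ∷ ls₁ ↭ b₂ ∷ ls₂) b≡ perm)) (Cut.ls-sorted c₁) (Cut.ls-sorted c₂)
  where
  perm : b₁ ∷ ls₁ ↭ b₂ ∷ ls₂
  perm = ↭-trans (freed-kept-↭ b₁ ls₁) (↭-trans (↭-reflexive (cong₂ _∷_ freed≡ kept≡)) (↭-sym (freed-kept-↭ b₂ ls₂)))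

  slots≡ : slots b₁ ls₁ ≡ slots b₂ ls₂
  slots≡ = strictly-sorted-unique <-asym
    (↭-trans (insertℕ-↭ b₁ ls₁) (↭-trans perm (↭-sym (insertℕ-↭ b₂ ls₂)))) (slots-sorted c₁) (slots-sorted c₂)

  b≡ : b₁ ≡ b₂
  b≡ = slots-injective {b₁} {b₂} {ls₁} {ls₂} slots≡ (trans (freedIndex-count c₁)
    (trans (cong₂ (λ v ls → total (λ l → ⟦ l <ᵇ v ⟧) ls) freed≡ kept≡) (sym (freedIndex-count c₂))))

step-injective : ∀ m {t b₁ b₂ R₁ R₂} → 1 ≤ t → t ≤ suc (2 * m) →
  IsMatching m ((1 , b₁) ∷ R₁) → IsMatching m ((1 , b₂) ∷ R₂) →
  step t b₁ R₁ ≡ step t b₂ R₂ → (1 , b₁) ∷ R₁ ≡ (1 , b₂) ∷ R₂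
step-injective m {t} {b₁} {b₂} {R₁} {R₂} 1≤t t≤ mN₁ mN₂ eq = go (stepCase m 1≤t t≤ mN₁) (stepCase m 1≤t t≤ mN₂)
  where
  unite : ∀ {b₂′ ls₂ rs₂ Y₂} → (1 , b₂) ∷ R₂ ↭ (1 , b₂′) ∷ zip ls₂ rs₂ ++ Y₂ →
    b₁ ≡ b₂′ → crossingLefts t R₁ ≡ ls₂ → crossingRights t R₁ ≡ rs₂ → otherEdges t R₁ ↭ Y₂ → (1 , b₁) ∷ R₁ ≡ (1 , b₂) ∷ R₂
  unite p refl refl refl Y↭ = matching-unique m mN₁ mN₂
    (↭-trans (cut-↭ t b₁ R₁) (↭-trans (↭-prep (1 , b₁) (++⁺ˡ (zip (crossingLefts t R₁) (crossingRights t R₁)) Y↭)) (↭-sym p)))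

  go : StepCase m t b₁ R₁ → StepCase m t b₂ R₂ → (1 , b₁) ∷ R₁ ≡ (1 , b₂) ∷ R₂
  go (aligned refl e₁) (aligned _ e₂) =
    mapE-shiftAt-injective 1 (proj₂ (∷-injective (trans (sym e₁) (trans eq e₂))))
  go (aligned refl _) (crossed (s≤s ()) _ _)
  go (aligned refl _) (nestedIn (s≤s ()) _ _)
  go (crossed (s≤s ()) _ _) (aligned refl _)
  go (nestedIn (s≤s ()) _ _) (aligned refl _)
  -- `b` is the first of the recovered right ends, and `ls` is recovered by removing the final `t`
  -- from the left ends.
  go (crossed 1<t t≤b₁ e₁) (crossed _ t≤b₂ e₂) =
    unite (cut-↭ t b₂ R₂) (proj₁ (∷-injective rs-≡)) (∷ʳ-injectiveˡ _ _ ls-≡) (proj₂ (∷-injective rs-≡)) Y-↭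
    where
    open SameParts (assemble-injective (cut m 1<t t≤ mN₁) (rewired-crossed (cut m 1<t t≤ mN₁) t≤b₁)
      (cut m 1<t t≤ mN₂) (rewired-crossed (cut m 1<t t≤ mN₂) t≤b₂) (trans (sym e₁) (trans eq e₂)))
  -- No edge closes at `t` in the first image, one does in the second.
  go (crossed 1<t t≤b₁ e₁) (nestedIn _ b₂<t e₂) = contradiction (↭-sym E-↭) ¬x∷xs↭[]
    where
    open SameParts (assemble-injective (cut m 1<t t≤ mN₁) (rewired-crossed (cut m 1<t t≤ mN₁) t≤b₁)
      (cut m 1<t t≤ mN₂) (rewired-nested (cut m 1<t t≤ mN₂) b₂<t) (trans (sym e₁) (trans eq e₂)))
  go (nestedIn 1<t b₁<t e₁) (crossed _ t≤b₂ e₂) = contradiction E-↭ ¬x∷xs↭[]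
    where
    open SameParts (assemble-injective (cut m 1<t t≤ mN₁) (rewired-nested (cut m 1<t t≤ mN₁) b₁<t)
      (cut m 1<t t≤ mN₂) (rewired-crossed (cut m 1<t t≤ mN₂) t≤b₂) (trans (sym e₁) (trans eq e₂)))
  go (nestedIn 1<t b₁<t e₁) (nestedIn _ b₂<t e₂) =
    unite (cut-↭ t b₂ R₂) (proj₁ b≡×ls≡) (proj₂ b≡×ls≡) rs-≡ Y-↭
    where
    c₁ : Cut m t b₁ (crossingLefts t R₁) (crossingRights t R₁) (otherEdges t R₁)
    c₁ = cut m 1<t t≤ mN₁
    c₂ : Cut m t b₂ (crossingLefts t R₂) (crossingRights t R₂) (otherEdges t R₂)
    c₂ = cut m 1<t t≤ mN₂
    open SameParts (assemble-injective c₁ (rewired-nested c₁ b₁<t) c₂ (rewired-nested c₂ b₂<t) (trans (sym e₁) (trans eq e₂)))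
    b≡×ls≡ : b₁ ≡ b₂ × crossingLefts t R₁ ≡ crossingLefts t R₂
    b≡×ls≡ = freed-injective c₁ c₂ (cong proj₁ (proj₁ (∷-injective (↭-singleton-inv E-↭)))) ls-≡

-- The statistic st under removal of the first edge

≤ᵇ-not : ∀ m n → (m ≤ᵇ n) ≡ not (n <ᵇ m)
≤ᵇ-not m n with m ≤? n
... | yes m≤n rewrite ≤ᵇ-true m≤n | <ᵇ-false m≤n = refl
... | no m≰n rewrite ≤ᵇ-false (≰⇒> m≰n) | <ᵇ-true (≰⇒> m≰n) = refl

embedding-≤ᵇ : ∀ {f} → Embedding f → ∀ x y → (f x ≤ᵇ f y) ≡ (x ≤ᵇ y)
embedding-≤ᵇ {f} emb x y = trans (≤ᵇ-not (f x) (f y)) (trans (cong not (emb y x)) (sym (≤ᵇ-not x y)))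

st-mapE : ∀ {f} → Embedding f → ∀ L → st (mapE f L) ≡ st L
st-mapE emb [] = refl
st-mapE emb (_ ∷ []) = refl
st-mapE {f} emb ((a , b) ∷ (c , d) ∷ L) = cong₂ _+_
  (cong₂ (λ p k → if p then k else 0) (nestedᵇ-map {f} emb a b c d)
    (trans (cong (count (λ v → (f d ≤ᵇ v) ∧ (v ≤ᵇ f b))) (vertices-mapE f ((c , d) ∷ L)))
      (count-map {p = λ v → (f d ≤ᵇ v) ∧ (v ≤ᵇ f b)} f (All.universal (λ v → cong₂ _∧_ (embedding-≤ᵇ {f} emb d v) (embedding-≤ᵇ {f} emb v b)) (vertices ((c , d) ∷ L))))))
  (st-mapE {f} emb ((c , d) ∷ L))

st-extend : ∀ t b R → st (extend t ((1 , b) ∷ R)) ≡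
  (if b <ᵇ t then count (between b t) (vertices ((1 , b) ∷ R)) else 0) + st ((1 , b) ∷ R)
st-extend t b R = cong₂ _+_
  (cong₂ (λ p k → if p then k else 0) first-nested
    (trans (cong (count (λ v → (ins b ≤ᵇ v) ∧ (v ≤ᵇ suc t))) (vertices-mapE ins ((1 , b) ∷ R)))
      (count-map {p = λ v → (ins b ≤ᵇ v) ∧ (v ≤ᵇ suc t)} ins (All.universal (λ v → cong₂ _∧_ (embedding-≤ᵇ {ins} (insRenum-embedding t) b v) (below v)) (vertices ((1 , b) ∷ R))))))
  (st-mapE {ins} (insRenum-embedding t) ((1 , b) ∷ R))
  where
  ins : ℕ → ℕ
  ins = insRenum (suc t)

  first-nested : nestedᵇ (1 , suc t) (ins 1 , ins b) ≡ (b <ᵇ t)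
  first-nested rewrite <ᵇ-true (1<insRenum t {1} ≤-refl) | <ᵇ-false (<⇒≤ (1<insRenum t {1} ≤-refl)) | insRenum-<ᵇ t b = ∨-identityʳ _

  below : ∀ v → (ins v ≤ᵇ suc t) ≡ (v <ᵇ t)
  below v = trans (≤ᵇ-not (ins v) (suc t)) (trans (cong not (<ᵇ-insRenum t v))
    (trans (cong not (≤ᵇ-not t v)) (not-involutive (v <ᵇ t))))

-- Induction on the number of edges

Decomposition : ℕ → RawMatching → Set
Decomposition m M = ∃ λ t → ∃ λ M₁ → M ≡ extend t M₁ × 1 ≤ t × t ≤ suc (2 * m) × IsMatching m M₁

-- Taking 1 and `suc t` out of the vertex set leaves exactly the image of `insRenum (suc t)`, on
-- which `delRenum (suc t)` is its inverse. Sortedness and orientation then pass to the smaller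
-- matching because the embedding reflects `<`.
decompose : ∀ m M → IsMatching (suc m) M → Decomposition m M
decompose m [] (_ , _ , p) with ↭-empty-inv (↭-sym p)
... | ()
decompose m ((a , zero) ∷ L) (_ , () ∷ _ , _)
decompose m ((a , suc t) ∷ L) mM with head-left m mM
decompose m ((_ , suc t) ∷ L) mM@(_ , s≤s 1≤t ∷ ordered , p) | refl =
  t , M₁ , cong ((1 , suc t) ∷_) L≡ , 1≤t , t≤ , AllPairs⇒Linked sorted₁ , ordered₁ , verts₁
  where
  ins del : ℕ → ℕ
  ins = insRenum (suc t)
  del = delRenum (suc t)

  M₁ : RawMatching
  M₁ = mapE del L

  del-ins : ∀ vs → map del (map ins vs) ≡ vs
  del-ins vs = trans (sym (map-∘ vs)) (map-id-local (All.universal (delRenum-insRenum t) vs))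

  t≤ : t ≤ suc (2 * m)
  t≤ with matching-bounds (suc m) ((1 , suc t) ∷ L) p
  ... | _ ∷ (_ , 1+t≤) ∷ _ = ≤-pred (≤-trans 1+t≤ (≤-reflexive (*-suc 2 m)))

  verts : vertices L ↭ map ins (range2n m)
  verts = drop-∷ (drop-∷ (↭-trans p (↭-trans (↭-reflexive (cong range (*-suc 2 m))) (range-insRenum (2 * m) 1≤t t≤))))

  L≡ : L ≡ mapE ins M₁
  L≡ = sym (trans (mapE-∘ ins del L) (mapE-id-local (All-resp-↭ (↭-sym verts)
    (All.map⁺ (All.universal (λ v → cong ins (delRenum-insRenum t v)) (range2n m))))))

  sorted₁ : AllPairs _<ₗ_ M₁
  sorted₁ = AllPairs.map (embedding-reflects {ins} (insRenum-embedding t))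
    (AllPairs.map⁻ (subst (AllPairs _<ₗ_) L≡ (AllPairs.tail (sorted-lefts (suc m) mM))))

  ordered₁ : All Ordered M₁
  ordered₁ = All.map (embedding-reflects {ins} (insRenum-embedding t)) (All.map⁻ (subst (All Ordered) L≡ ordered))

  verts₁ : vertices M₁ ↭ range2n m
  verts₁ = subst₂ _↭_ (sym (vertices-mapE del L)) (del-ins (range2n m)) (map⁺ del verts)

-- The same `b` heads the smaller matching and its image, while `R` and `R′` may differ: `st` looks
-- at the former, `step` acts on the latter.
record Unfolding (m : ℕ) (M : RawMatching) : Set where
  field
    t b : ℕ
    R R′ : RawMatching
    M≡ : M ≡ extend t ((1 , b) ∷ R)
    1≤t : 1 ≤ t
    t≤ : t ≤ suc (2 * m)
    matching : IsMatching m ((1 , b) ∷ R)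
    φ-matching : IsMatching m ((1 , b) ∷ R′)
    φ-head : φ' m ((1 , b) ∷ R) ≡ (1 , b) ∷ R′
    φ-step : φ' (suc m) M ≡ step t b R′

φ′-singleton : ∀ {M} → IsMatching 1 M → φ' 1 M ≡ M
φ′-singleton {[]}         _ = refl
φ′-singleton {_ ∷ []}     _ = refl
φ′-singleton {_ ∷ _ ∷ _}  mM with matching-length 1 mM
... | ()

SameHead : RawMatching → RawMatching → Set
SameHead M N = ∀ {e R} → M ≡ e ∷ R → ∃ λ R′ → N ≡ e ∷ R′

-- The head belongs to the induction hypothesis because `combine` takes its second edge from M but
-- operates on the image of the smaller matching.
Preserves : ℕ → Set
Preserves n = ∀ {M} → IsMatching n M → IsMatching n (φ' n M) × SameHead M (φ' n M)

unfold : ∀ m {M} → Preserves (suc m) → IsMatching (suc (suc m)) M → Unfolding (suc m) M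
unfold m {M} preserves mM with decompose (suc m) M mM
... | t , [] , _ , _ , _ , m₁ = contradiction (matching-length (suc m) m₁) (λ ())
... | t , (a , b) ∷ R , M≡ , 1≤t , t≤ , m₁ with head-left m m₁
... | refl with preserves m₁
... | φ₁ , same with same refl
... | R′ , φ₁≡ = record
  { M≡ = M≡ ; 1≤t = 1≤t ; t≤ = t≤ ; matching = m₁
  ; φ-matching = subst (IsMatching (suc m)) φ₁≡ φ₁
  ; φ-head = φ₁≡
  ; φ-step = trans (cong (φ' (suc (suc m))) M≡) (trans (φ′-extend (suc m) t b R)
      (cong (combine 1 (suc t) (insRenum (suc t) 1) (insRenum (suc t) b)) φ₁≡))
  }

unfolding-preserves : ∀ m {M} → Unfolding (suc m) M → IsMatching (suc (suc m)) (φ' (suc (suc m)) M) × SameHead M (φ' (suc (suc m)) M)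
unfolding-preserves m {M} u =
  subst (IsMatching (suc (suc m))) (sym φ-step) (step-matching (suc m) 1≤t t≤ φ-matching) , same
  where
  open Unfolding u
  same : SameHead M (φ' (suc (suc m)) M)
  same eq with step-head (suc m) 1≤t t≤ φ-matching
  ... | R″ , head = R″ , trans φ-step (trans head (cong (_∷ R″) (proj₁ (∷-injective (trans (sym M≡) eq)))))

φ′-preserves : ∀ n → Preserves n
φ′-preserves zero mM = mM , λ eq → _ , eq
φ′-preserves (suc zero) mM = subst (IsMatching 1) (sym (φ′-singleton mM)) mM , λ eq → _ , trans (φ′-singleton mM) eq
φ′-preserves (suc (suc m)) mM = unfolding-preserves m (unfold m (φ′-preserves (suc m)) mM)

-- The first edge of the image gives `t`. With `t` known one step can be undone, which yields the
-- image of the smaller matching, and the induction hypothesis applies to it.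
φ′-injective : ∀ n {M M′} → IsMatching n M → IsMatching n M′ → φ' n M ≡ φ' n M′ → M ≡ M′
φ′-injective zero _ _ eq = eq
φ′-injective (suc zero) mM mM′ eq = trans (sym (φ′-singleton mM)) (trans eq (φ′-singleton mM′))
φ′-injective (suc (suc m)) {M} {M′} mM mM′ eq = trans U.M≡
  (trans (cong₂ extend t≡ (φ′-injective (suc m) U.matching U′.matching (trans U.φ-head (trans N₁≡ (sym U′.φ-head)))))
    (sym U′.M≡))
  where
  module U = Unfolding (unfold m (φ′-preserves (suc m)) mM)
  module U′ = Unfolding (unfold m (φ′-preserves (suc m)) mM′)

  steps≡ : step U.t U.b U.R′ ≡ step U′.t U′.b U′.R′
  steps≡ = trans (sym U.φ-step) (trans eq U′.φ-step)

  t≡ : U.t ≡ U′.t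
  t≡ with step-head (suc m) U.1≤t U.t≤ U.φ-matching | step-head (suc m) U′.1≤t U′.t≤ U′.φ-matching
  ... | _ , head | _ , head′ = suc-injective (cong proj₂ (proj₁ (∷-injective (trans (sym head) (trans steps≡ head′)))))

  N₁≡ : (1 , U.b) ∷ U.R′ ≡ (1 , U′.b) ∷ U′.R′
  N₁≡ = step-injective (suc m) U.1≤t U.t≤ U.φ-matching U′.φ-matching
    (trans steps≡ (cong (λ t → step t U′.b U′.R′) (sym t≡)))

ne-φ′ : ∀ n {M} → IsMatching n M → ne (φ' n M) ≡ st M
ne-φ′ zero {[]} mM = refl
ne-φ′ zero {_ ∷ _} mM with matching-length 0 mM
... | ()
ne-φ′ (suc zero) {[]} _ = refl
ne-φ′ (suc zero) {_ ∷ []} _ = refl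
ne-φ′ (suc zero) {_ ∷ _ ∷ _} mM with matching-length 1 mM
... | ()
ne-φ′ (suc (suc m)) {M} mM = begin
  ne (φ' (suc (suc m)) M)
    ≡⟨ cong ne φ-step ⟩
  ne (step t b R′)
    ≡⟨ step-ne (suc m) 1≤t t≤ φ-matching ⟩
  (if b <ᵇ t then count (between b t) (range2n (suc m)) else 0) + ne ((1 , b) ∷ R′)
    -- The window count depends on the vertex set only, so it is the same for the smaller matching,
    -- where `st` takes it, and for its image, where the nestings are gained.
    ≡⟨ cong₂ (λ k l → (if b <ᵇ t then k else 0) + l)
         (sym (count-↭ (between b t) (proj₂ (proj₂ matching))))
         (trans (cong ne (sym φ-head)) (ne-φ′ (suc m) matching)) ⟩
  (if b <ᵇ t then count (between b t) (vertices ((1 , b) ∷ R)) else 0) + st ((1 , b) ∷ R)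
    ≡⟨ st-extend t b R ⟨
  st (extend t ((1 , b) ∷ R))
    ≡⟨ cong st M≡ ⟨
  st M ∎
  where
  open ≡-Reasoning
  open Unfolding (unfold m (φ′-preserves (suc m)) mM)

-- Finiteness and surjectivity

lists : ∀ {A : Set} → ℕ → List A → List (List A)
lists zero    xs = [ [] ]
lists (suc n) xs = cartesianProductWith _∷_ xs (lists n xs)

∈-lists : ∀ {A : Set} {xs : List A} ys → All (_∈ xs) ys → ys ∈ lists (length ys) xs
∈-lists []       []       = here refl
∈-lists (y ∷ ys) (y∈ ∷ ∈) = ∈-cartesianProductWith⁺ _∷_ y∈ (∈-lists ys ∈)

-- A generous bound suffices for the pigeonhole argument: all lists of n pairs of vertices,
-- matchings or not.
matchings-finite : ∀ n → ∃ λ Ms → ∀ {M} → IsMatching n M → M ∈ Ms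
matchings-finite n = lists n (cartesianProduct (range2n n) (range2n n)) , λ {M} mM →
  subst (λ k → M ∈ lists k _) (matching-length n mM)
    (∈-lists M (All.map (λ ((1≤a , a≤) , (1≤b , b≤)) → ∈-cartesianProduct⁺ (∈-range 1≤a a≤) (∈-range 1≤b b≤))
      (All-ends (matching-bounds n M (proj₂ (proj₂ mM))))))

-- By pigeonhole two iterates f^i x and f^j x (i < j) coincide; cancelling f^i leaves x = f^(j-i) x.
injective⇒surjective : ∀ {A : Set} {P : A → Set} {xs : List A} {f : A → A} → (∀ {x} → P x → x ∈ xs) →
  (∀ {x} → P x → P (f x)) → (∀ {x y} → P x → P y → f x ≡ f y → x ≡ y) →
  ∀ {y} → P y → ∃ λ x → P x × f x ≡ y
injective⇒surjective {A} {P} {xs} {f} P⊆xs closed injective {y} Py = preimage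
  where
  iterate : ℕ → A
  iterate zero    = y
  iterate (suc k) = f (iterate k)

  P-iterate : ∀ k → P (iterate k)
  P-iterate zero    = Py
  P-iterate (suc k) = closed (P-iterate k)

  position : Fin (suc (length xs)) → Fin (length xs)
  position i = index (P⊆xs (P-iterate (toℕ i)))

  position-injective : ∀ i j → position i ≡ position j → iterate (toℕ i) ≡ iterate (toℕ j)
  position-injective i j eq = trans (lookup-index (P⊆xs (P-iterate (toℕ i))))
    (trans (cong (lookup xs) eq) (sym (lookup-index (P⊆xs (P-iterate (toℕ j))))))

  cancel : ∀ i j → i < j → iterate i ≡ iterate j → ∃ λ x → P x × f x ≡ y
  cancel zero    (suc j) _         eq = iterate j , P-iterate j , sym eq
  cancel (suc i) (suc j) (s≤s i<j) eq = cancel i j i<j (injective (P-iterate i) (P-iterate j) eq)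

  preimage : ∃ λ x → P x × f x ≡ y
  preimage with pigeonhole ≤-refl position
  ... | i , j , i<j , eq = cancel (toℕ i) (toℕ j) i<j (position-injective i j eq)

theorem2 : (n : ℕ) → 1 ≤ n →
    ((M : RawMatching) → IsMatching n M → IsMatching n (φ M))
    × ((M M′ : RawMatching) → IsMatching n M → IsMatching n M′ → φ M ≡ φ M′ → M ≡ M′)
    × ((N : RawMatching) → IsMatching n N → Σ RawMatching (λ M → IsMatching n M × φ M ≡ N))
    × ((M : RawMatching) → IsMatching n M → ne (φ M) ≡ st M)
theorem2 n _ =
  (λ M mM → matching mM) ,
  (λ M M′ → injective) ,
  (λ N mN → injective⇒surjective (proj₂ (matchings-finite n)) matching injective mN) ,
  (λ M mM → trans (cong ne (φ≡φ′ mM)) (ne-φ′ n mM))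
  where
  -- `φ` takes the length of M as its recursion depth, and a matching on [2n] has n edges.
  φ≡φ′ : ∀ {M} → IsMatching n M → φ M ≡ φ' n M
  φ≡φ′ {M} mM = cong (λ k → φ' k M) (matching-length n mM)

  matching : ∀ {M} → IsMatching n M → IsMatching n (φ M)
  matching mM = subst (IsMatching n) (sym (φ≡φ′ mM)) (proj₁ (φ′-preserves n mM))

  injective : ∀ {M M′} → IsMatching n M → IsMatching n M′ → φ M ≡ φ M′ → M ≡ M′
  injective mM mM′ eq = φ′-injective n mM mM′ (trans (sym (φ≡φ′ mM)) (trans eq (φ≡φ′ mM′)))
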